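{- Satisfiability of ND-LTL is undecidable over finite data words and also over infinite data words. Satisfiability of $\mathrm{ND\text{ - }LTL}^-$ is undecidable over infinite data words.
   Context: Fix an infinite data domain $\Delta$, a finite set $AP$ of atomic propositions, and a finite attribute set $A$ with a tree order $\le$ (a partial order such that for every $x$, $x^\downarrow=\{y:y\le x\}$ is linearly ordered). Data words are finite or infinite sequences $w=(a_0,\vec d_0)(a_1,\vec d_1)\cdots$ with $a_i\in 2^{AP}$, $\vec d_i:A\to\Delta$. Syntax: position formulae $\varphi ::= p\mid\varphi\wedge\varphi\mid\neg\varphi\mid\mathrm X\varphi\mid\mathrm Y\varphi\mid\varphi\mathrm U\varphi\mid\varphi\mathrm S\varphi\mid\mathrm C^r_x\psi$; class formulae $\psi::=@x\mid\psi\wedge\psi\mid\neg\psi\mid\mathrm X^=\psi\mid\mathrm Y^=\psi\mid\psi\mathrm U^=\psi\mid\psi\mathrm S^=\psi\mid\varphi$ ($p\in AP$, $x\in A$, $r\in\mathbb Z$). For $x\in A$ with $x^\downarrow=\{x_1<\dots<x_n\}$ and $\vec d\in\Delta^{x^\downarrow}$ associate the vector $(\vec d(x_1),\dots,\vec d(x_n))$; $\vec d\simeq\vec d'$ if they have the same vector. Let $\mathrm{pos}_{\vec d}(w)=\{i:\exists y\in A,\ \vec d\simeq\vec d_i|_{y^\downarrow}\}$. Position formulae at $(w,i)$: $p$ iff $p\in a_i$; Boolean and LTL operators as usual; $(w,i)\models\mathrm C^r_x\psi$ iff $0\le i+r<|w|$ and $(w,i+r,\vec d_i|_{x^\downarrow})\models\psi$.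 Class formulae at $(w,i,\vec d)$: $\varphi$ iff $(w,i)\models\varphi$; $@x$ iff $\vec d_i|_{x^\downarrow}\simeq\vec d$; $\mathrm X^=\psi$ iff some $j\in\mathrm{pos}_{\vec d}(w)$ has $j>i$ and for the smallest such $j$, $(w,j,\vec d)\models\psi$; $\psi_1\mathrm U^=\psi_2$ iff some $j\in\mathrm{pos}_{\vec d}(w)$, $j\ge i$, satisfies $\psi_2$ and all $j'\in\mathrm{pos}_{\vec d}(w)$ with $i\le j'<j$ satisfy $\psi_1$; $\mathrm Y^=,\mathrm S^=$ are the symmetric past versions. A formula is satisfiable over finite (infinite) data words if $(w,0)\models\varphi$ for some finite (infinite) $w$. $\mathrm{ND\text{ - }LTL}^-$ is the fragment without $\mathrm X^=$ and $\mathrm U^=$. -}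

module Defs where

open import Data.Nat using (ℕ; zero; suc; _<_; _≤_; _≥_; _>_; _∸_)
open import Data.Fin using (Fin; toℕ)
open import Data.Integer using (ℤ; +_; -[1+_]) renaming (_+_ to _+ℤ_)
open import Data.Bool using (Bool; true; false)
open import Data.List using (List; []; _∷_; _++_; [_]; map; length)
open import Data.Maybe using (Maybe; just; nothing)
open import Data.Product using (Σ; ∃; _×_; _,_)
open import Data.Unit using (⊤)
open import Data.Empty using (⊥)
open import Relation.Nullary using (¬_; Dec)
open import Relation.Binary.PropositionalEquality using (_≡_)
open import Function.Definitions using (Injective)

-- Attribute sets with a tree order.
-- A finite attribute set is Fin n.  A finite tree order (partial order in
-- which every down-set x↓ is a chain) is exactly a finite forest; we
-- present it by the immediate-predecessor (parent) map, with attributes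
-- numbered in a topological order (parent index smaller than child index).
-- x↓ = reflexive-transitive ancestors of x.

record Forest (n : ℕ) : Set where
  field
    parent    : Fin n → Maybe (Fin n)
    parent-lt : ∀ x p → parent x ≡ just p → toℕ p < toℕ x

open Forest public

module _ {n : ℕ} (F : Forest n) where
  -- the chain x↓ = {x₁ < … < xₘ = x}, listed in increasing order
  -- (fuel n suffices since the depth of any attribute is < n)
  chainF : ℕ → Fin n → List (Fin n)
  chainF zero    x = [ x ]
  chainF (suc f) x with parent F x
  ... | nothing = [ x ]
  ... | just p  = chainF f p ++ [ x ]

  chain : Fin n → List (Fin n)
  chain x = chainF n x

data PForm (k n : ℕ) : Set
data CForm (k n : ℕ) : Set

data PForm k n where
  prop  : Fin k → PForm k n
  _∧_   : PForm k n → PForm k n → PForm k n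
  ¬ᶠ_   : PForm k n → PForm k n
  X Y   : PForm k n → PForm k n
  _U_ _S_ : PForm k n → PForm k n → PForm k n
  C     : ℤ → Fin n → CForm k n → PForm k n

data CForm k n where
  at    : Fin n → CForm k n
  _∧ᶜ_  : CForm k n → CForm k n → CForm k n
  ¬ᶜ_   : CForm k n → CForm k n
  X⁼ Y⁼ : CForm k n → CForm k n
  _U⁼_ _S⁼_ : CForm k n → CForm k n → CForm k n
  pos   : PForm k n → CForm k n

data MinusP {k n : ℕ} : PForm k n → Set
data MinusC {k n : ℕ} : CForm k n → Set

data MinusP {k} {n} where
  prop : ∀ p → MinusP (prop p)
  _∧_  : ∀ {φ ψ} → MinusP φ → MinusP ψ → MinusP (φ ∧ ψ)
  ¬ᶠ_  : ∀ {φ} → MinusP φ → MinusP (¬ᶠ φ)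
  X    : ∀ {φ} → MinusP φ → MinusP (X φ)
  Y    : ∀ {φ} → MinusP φ → MinusP (Y φ)
  _U_  : ∀ {φ ψ} → MinusP φ → MinusP ψ → MinusP (φ U ψ)
  _S_  : ∀ {φ ψ} → MinusP φ → MinusP ψ → MinusP (φ S ψ)
  C    : ∀ r x {ψ} → MinusC ψ → MinusP (C r x ψ)

data MinusC {k} {n} where
  at    : ∀ x → MinusC (at x)
  _∧ᶜ_  : ∀ {φ ψ} → MinusC φ → MinusC ψ → MinusC (φ ∧ᶜ ψ)
  ¬ᶜ_   : ∀ {φ} → MinusC φ → MinusC (¬ᶜ φ)
  Y⁼    : ∀ {φ} → MinusC φ → MinusC (Y⁼ φ)
  _S⁼_  : ∀ {φ ψ} → MinusC φ → MinusC ψ → MinusC (φ S⁼ ψ)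
  pos   : ∀ {φ} → MinusP φ → MinusC (pos φ)

-- Data words: finite (length m) or infinite.  Letters are given at every
-- ℕ-position; for finite words only positions < m are part of the word.

data Len : Set where
  fin : ℕ → Len
  inf : Len

InW : Len → ℕ → Set
InW (fin m) i = i < m
InW inf     i = ⊤

record Word (Δ : Set) (k n : ℕ) : Set where
  field
    len : Len
    lab : ℕ → Fin k → Bool
    dat : ℕ → Fin n → Δ

open Word public

shift : ℕ → ℤ → Maybe ℕ
shift i r with (+ i) +ℤ r
... | + m     = just m
... | -[1+ _ ] = nothing

-- Semantics.  A class vector d ∈ Δ^{x↓} is represented by its associated
-- vector (d(x₁),…,d(xₘ)) : List Δ, so d ≃ d' is equality of these lists.

module Semantics {Δ : Set} {k n : ℕ} (F : Forest n) (w : Word Δ k n) where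

  vec : ℕ → Fin n → List Δ
  vec i x = map (dat w i) (chain F x)

  Pos : List Δ → ℕ → Set
  Pos d i = InW (len w) i × ∃ λ y → vec i y ≡ d

  _⊨_ : ℕ → PForm k n → Set
  _⊨ᶜ_ : ℕ × List Δ → CForm k n → Set

  i ⊨ prop p  = lab w i p ≡ true
  i ⊨ (φ ∧ ψ) = (i ⊨ φ) × (i ⊨ ψ)
  i ⊨ (¬ᶠ φ)  = ¬ (i ⊨ φ)
  i ⊨ X φ     = InW (len w) (suc i) × (suc i ⊨ φ)
  i ⊨ Y φ     = Σ ℕ λ j → (suc j ≡ i) × (j ⊨ φ)
  i ⊨ (φ U ψ) = Σ ℕ λ j → (i ≤ j) × InW (len w) j × (j ⊨ ψ)
                  × (∀ j' → i ≤ j' → j' < j → j' ⊨ φ)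
  i ⊨ (φ S ψ) = Σ ℕ λ j → (j ≤ i) × (j ⊨ ψ)
                  × (∀ j' → j < j' → j' ≤ i → j' ⊨ φ)
  i ⊨ C r x ψ = Σ ℕ λ j → (shift i r ≡ just j) × InW (len w) j
                  × ((j , vec i x) ⊨ᶜ ψ)

  (i , d) ⊨ᶜ at x     = vec i x ≡ d
  (i , d) ⊨ᶜ (φ ∧ᶜ ψ) = ((i , d) ⊨ᶜ φ) × ((i , d) ⊨ᶜ ψ)
  (i , d) ⊨ᶜ (¬ᶜ φ)   = ¬ ((i , d) ⊨ᶜ φ)
  (i , d) ⊨ᶜ X⁼ ψ     = Σ ℕ λ j → (i < j) × Pos d j
                          × (∀ j' → i < j' → j' < j → ¬ Pos d j')
                          × ((j , d) ⊨ᶜ ψ)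
  (i , d) ⊨ᶜ Y⁼ ψ     = Σ ℕ λ j → (j < i) × Pos d j
                          × (∀ j' → j < j' → j' < i → ¬ Pos d j')
                          × ((j , d) ⊨ᶜ ψ)
  (i , d) ⊨ᶜ (φ U⁼ ψ) = Σ ℕ λ j → (i ≤ j) × Pos d j × ((j , d) ⊨ᶜ ψ)
                          × (∀ j' → Pos d j' → i ≤ j' → j' < j → (j' , d) ⊨ᶜ φ)
  (i , d) ⊨ᶜ (φ S⁼ ψ) = Σ ℕ λ j → (j ≤ i) × Pos d j × ((j , d) ⊨ᶜ ψ)
                          × (∀ j' → Pos d j' → j < j' → j' ≤ i → (j' , d) ⊨ᶜ φ)
  (i , d) ⊨ᶜ pos φ    = i ⊨ φ

record Instance : Set where
  field
    nProps : ℕ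
    nAttrs : ℕ
    order  : Forest nAttrs
    formula : PForm nProps nAttrs

open Instance public

-- satisfiable over finite data words (non-empty: position 0 must exist)
SatFin : (Δ : Set) → Instance → Set
SatFin Δ I = Σ (Word Δ (nProps I) (nAttrs I)) λ w →
  Σ ℕ λ m → (len w ≡ fin (suc m)) × Semantics._⊨_ (order I) w 0 (formula I)

SatInf : (Δ : Set) → Instance → Set
SatInf Δ I = Σ (Word Δ (nProps I) (nAttrs I)) λ w →
  (len w ≡ inf) × Semantics._⊨_ (order I) w 0 (formula I)

InstanceMinus : Set
InstanceMinus = Σ Instance λ I → MinusP (formula I)

data Instr : Set where
  inc : Bool → ℕ → Instr
  dec : Bool → ℕ → ℕ → Instr

Program : Set
Program = List Instr

record Config : Set where
  constructor ⟨_,_,_⟩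
  field
    pc : ℕ
    c₀ : ℕ
    c₁ : ℕ

nth : {A : Set} → List A → ℕ → Maybe A
nth []       _       = nothing
nth (x ∷ _)  zero    = just x
nth (_ ∷ xs) (suc i) = nth xs i

exec : Instr → Config → Config
exec (inc false j)    ⟨ _ , a , b ⟩ = ⟨ j , suc a , b ⟩
exec (inc true  j)    ⟨ _ , a , b ⟩ = ⟨ j , a , suc b ⟩
exec (dec false j _)  ⟨ _ , zero  , b ⟩ = ⟨ j , zero , b ⟩
exec (dec false _ j') ⟨ _ , suc a , b ⟩ = ⟨ j' , a , b ⟩
exec (dec true  j _)  ⟨ _ , a , zero  ⟩ = ⟨ j , a , zero ⟩
exec (dec true  _ j') ⟨ _ , a , suc b ⟩ = ⟨ j' , a , b ⟩

-- one step; a configuration whose pc is outside the program is halted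
step : Program → Config → Config
step P c with nth P (Config.pc c)
... | nothing = c
... | just ι  = exec ι c

run : Program → ℕ → Config → Config
run P zero    c = c
run P (suc t) c = run P t (step P c)

Halts : Program → Set
Halts P = Σ ℕ λ t → nth P (Config.pc (run P t ⟨ 0 , 0 , 0 ⟩)) ≡ nothing

-- Synthetic undecidability: a decider for Q yields a decider for the
-- (undecidable) halting problem of two-counter Minsky machines.

Undecidable : {X : Set} → (X → Set) → Set
Undecidable Q = (∀ x → Dec (Q x)) → ∀ P → Dec (Halts P)

Infinite : Set → Set
Infinite Δ = Σ (ℕ → Δ) Injective-≡
  where
  Injective-≡ : (ℕ → Δ) → Set
  Injective-≡ f = Injective _≡_ _≡_ f

-- A word is cut into blocks, each describing a configuration of a two-counter machine: every
-- position is a token labelled free, counter 0, counter 1 or used. The block identifier and a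
-- value form nested data, by which a token of one block points to a distinct token of the
-- previous block; so with past modalities only, tokens can get lost but never appear. A machine
-- step relabels exactly one token, placed first in the new block: an increment uses up a free
-- token, a decrement or zero test makes a token used. When the machine halts, the next block
-- restarts it with all tokens free.
--
-- Since every step lowers a potential, an infinite word restarts again and again, and since
-- blocks never grow, some round loses no token and is a faithful halting run. Its length is
-- bounded by twice the size of the first block. Conversely a halting run yields a word that
-- repeats it forever. On finite words, a future modality forbids losses directly.
module Submission where

open import Defs
open import Data.Bool using (Bool; true; false; if_then_else_)
import Data.Bool as Bool
open import Data.Bool.Properties using (¬-not)
open import Data.Empty using (⊥; ⊥-elim)
open import Data.Fin using (Fin; zero; suc; toℕ)
open import Data.Fin.Properties using (any?; toℕ<n)
open import Data.Integer using (0ℤ; -1ℤ)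
open import Data.List using ([]; _∷_; length; lookup)
open import Data.List.Properties using (∷-injectiveˡ; ∷-injectiveʳ)
open import Data.Maybe using (Maybe; just; nothing)
open import Data.Maybe.Properties using (just-injective)
open import Data.Nat using (ℕ; zero; suc; _+_; _*_; _∸_; _≤_; _<_; z≤n; s≤s; s≤s⁻¹; _≡ᵇ_; _≤?_; _<?_; _≟_)
open import Data.Nat.Properties
open import Data.Product using (Σ; ∃; _×_; _,_; proj₁; proj₂)
open import Data.Sum using (_⊎_; inj₁; inj₂)
open import Data.Unit using (⊤; tt)
open import Function using (_∘_; const)
open import Relation.Binary.Definitions using (Tri; tri<; tri≈; tri>)
open import Relation.Binary.PropositionalEquality
open import Relation.Nullary using (¬_; Dec; yes; no)
open import Relation.Nullary.Decidable using (map′)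
open import Algebra.Properties.CommutativeSemigroup +-commutativeSemigroup using (x∙yz≈y∙xz; interchange)

true≢false : true ≢ false
true≢false ()

nothing≢just : ∀ {A : Set} {x : A} → nothing ≢ just x
nothing≢just ()

-- Finite sums

∑ : ℕ → (ℕ → ℕ) → ℕ
∑ zero    h = 0
∑ (suc n) h = h 0 + ∑ n (h ∘ suc)

∑-cong : ∀ n {h g : ℕ → ℕ} → (∀ o → o < n → h o ≡ g o) → ∑ n h ≡ ∑ n g
∑-cong zero    eq = refl
∑-cong (suc n) eq = cong₂ _+_ (eq 0 (s≤s z≤n)) (∑-cong n (λ o o<n → eq (suc o) (s≤s o<n)))

∑-+ : ∀ n (h g : ℕ → ℕ) → ∑ n h + ∑ n g ≡ ∑ n (λ o → h o + g o)
∑-+ zero    h g = refl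
∑-+ (suc n) h g = trans (interchange (h 0) _ (g 0) _) (cong (h 0 + g 0 +_) (∑-+ n (h ∘ suc) (g ∘ suc)))

∑-const : ∀ n k → ∑ n (const k) ≡ n * k
∑-const zero    k = refl
∑-const (suc n) k = cong (k +_) (∑-const n k)

∑-one : ∀ n → ∑ n (const 1) ≡ n
∑-one n = trans (∑-const n 1) (*-identityʳ n)

∑-mono : ∀ n {h g : ℕ → ℕ} → (∀ o → h o ≤ g o) → ∑ n h ≤ ∑ n g
∑-mono zero    le = z≤n
∑-mono (suc n) le = +-mono-≤ (le 0) (∑-mono n (le ∘ suc))

∑-zero : ∀ n {h : ℕ → ℕ} → (∀ o → o < n → h o ≡ 0) → ∑ n h ≡ 0
∑-zero n eq = trans (∑-cong n eq) (trans (∑-const n 0) (*-zeroʳ n))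

term≤∑ : ∀ {n} (h : ℕ → ℕ) {o} → o < n → h o ≤ ∑ n h
term≤∑ h {zero}  (s≤s _)   = m≤m+n (h 0) _
term≤∑ h {suc o} (s≤s o<n) = ≤-trans (term≤∑ (h ∘ suc) o<n) (m≤n+m _ (h 0))

∑-positive : ∀ n (h : ℕ → ℕ) → 0 < ∑ n h → ∃ λ o → o < n × 0 < h o
∑-positive (suc n) h lt with h 0 in eq
... | suc _ = 0 , s≤s z≤n , subst (0 <_) (sym eq) (s≤s z≤n)
... | zero with ∑-positive n (h ∘ suc) lt
...   | o , o<n , lt′ = suc o , s≤s o<n , lt′

-- The increasing enumeration of the naturals other than the first argument: `punchIn` without
-- bounds.
punch : ℕ → ℕ → ℕ
punch zero    o       = suc o
punch (suc x) zero    = zero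
punch (suc x) (suc o) = suc (punch x o)

punch-≤ : ∀ x {o n} → o < n → punch x o ≤ n
punch-≤ zero    o<n = o<n
punch-≤ (suc x) {zero}  o<n = z≤n
punch-≤ (suc x) {suc o} (s≤s o<n) = s≤s (punch-≤ x o<n)

punch-≢ : ∀ x o → punch x o ≢ x
punch-≢ (suc x) (suc o) eq = punch-≢ x o (suc-injective eq)

punch-injective : ∀ x {o o′} → punch x o ≡ punch x o′ → o ≡ o′
punch-injective zero    eq = suc-injective eq
punch-injective (suc x) {zero}  {zero}   eq = refl
punch-injective (suc x) {suc o} {suc o′} eq = cong suc (punch-injective x (suc-injective eq))

punch-surjective : ∀ x {y n} → x ≤ n → y ≤ n → y ≢ x → ∃ λ o → o < n × punch x o ≡ y
punch-surjective zero    {zero}  _ _ y≢x = ⊥-elim (y≢x refl)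
punch-surjective zero    {suc y} _ y≤n _ = y , y≤n , refl
punch-surjective (suc x) {zero}  (s≤s _) _ _ = 0 , s≤s z≤n , refl
punch-surjective (suc x) {suc y} (s≤s x≤n) (s≤s y≤n) y≢x
  with punch-surjective x x≤n y≤n (y≢x ∘ cong suc)
... | o , o<n , eq = suc o , s≤s o<n , cong suc eq

∑-remove : ∀ {x n} (h : ℕ → ℕ) → x ≤ n → ∑ (suc n) h ≡ h x + ∑ n (h ∘ punch x)
∑-remove {zero}  h x≤n = refl
∑-remove {suc x} {suc n} h (s≤s x≤n) =
  trans (cong (h 0 +_) (∑-remove (h ∘ suc) x≤n)) (x∙yz≈y∙xz (h 0) (h (suc x)) _)

-- Induction on `n`: the index `x` matched with 0 is removed from the larger sum by `punch`, and
-- injectivity keeps the other matches away from `x`. `R` is a relation because tokens will be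
-- matched by equality of data.
∑-injection : ∀ n m {h g : ℕ → ℕ} (R : ℕ → ℕ → Set)
  → (∀ i → i < n → ∃ λ j → j < m × R i j × h i ≤ g j)
  → (∀ {i i′ j} → i < n → i′ < n → R i j → R i′ j → i ≡ i′)
  → ∑ n h ≤ ∑ m g
∑-injection zero    m R total inj = z≤n
∑-injection (suc n) m {h} {g} R total inj with total 0 (s≤s z≤n)
∑-injection (suc n) (suc m) {h} {g} R total inj | x , s≤s x≤m , r , le =
  ≤-trans (+-mono-≤ le (∑-injection n m (λ i j → R (suc i) (punch x j)) total′
                          (λ i<n i′<n r₁ r₂ → suc-injective (inj (s≤s i<n) (s≤s i′<n) r₁ r₂))))
          (≤-reflexive (sym (∑-remove g x≤m)))
  where
  total′ : ∀ i → i < n → ∃ λ j → j < m × R (suc i) (punch x j) × h (suc i) ≤ g (punch x j)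
  total′ i i<n with total (suc i) (s≤s i<n)
  ... | y , s≤s y≤m , r′ , le′ with punch-surjective x x≤m y≤m
          (λ { refl → 1+n≢0 (inj (s≤s i<n) (s≤s z≤n) r′ r) })
  ...   | o , o<m , refl = o , o<m , r′ , le′

-- Token labels

Label : Set
Label = Bool × Bool

free used : Label
free = false , false
used = true , true

token : Bool → Label
token false = true , false
token true  = false , true

_≟ᵇ_ : Bool → Bool → Bool
true  ≟ᵇ v = v
false ≟ᵇ v = Bool.not v

δ : Label → Label → ℕ
δ (u , v) (u′ , v′) = if (u ≟ᵇ u′) Bool.∧ (v ≟ᵇ v′) then 1 else 0

δ-refl : ∀ ℓ → δ ℓ ℓ ≡ 1
δ-refl (true  , true)  = refl
δ-refl (true  , false) = refl
δ-refl (false , true)  = refl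
δ-refl (false , false) = refl

δ-positive : ∀ ℓ ℓ′ → 0 < δ ℓ ℓ′ → ℓ′ ≡ ℓ
δ-positive (true  , true)  (true  , true)  _ = refl
δ-positive (true  , false) (true  , false) _ = refl
δ-positive (false , true)  (false , true)  _ = refl
δ-positive (false , false) (false , false) _ = refl

δ≤1 : ∀ ℓ ℓ′ → δ ℓ ℓ′ ≤ 1
δ≤1 (u , v) (u′ , v′) with (u ≟ᵇ u′) Bool.∧ (v ≟ᵇ v′)
... | true  = ≤-refl
... | false = z≤n

δ-≢ : ∀ {ℓ ℓ′} → ℓ′ ≢ ℓ → δ ℓ ℓ′ ≡ 0
δ-≢ {ℓ} {ℓ′} ne with δ ℓ ℓ′ in eq
... | zero  = refl
... | suc _ = ⊥-elim (ne (δ-positive ℓ ℓ′ (subst (0 <_) (sym eq) (s≤s z≤n))))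

-- How an instruction may act: the token label that must be absent (if any),
-- the next program counter, and the relabelling of the one token that changes.
record Action : Set where
  constructor action
  field
    absent  : Maybe Label
    target  : ℕ
    old new : Label

open Action

-- The Boolean guesses the outcome of the test in `dec`: `false` for zero, `true` for positive. A
-- zero test also spends a free token, so that it lowers the potential like any other action.
act : Bool → Instr → Action
act _     (inc c j)    = action nothing j free (token c)
act false (dec c j _)  = action (just (token c)) j free used
act true  (dec c _ j′) = action nothing j′ (token c) used

-- An upper bound on how often a token can still be relabelled: free to counter to used, or free to
-- used directly.
potential : Label → ℕ
potential (false , false) = 2
potential (true  , true)  = 0
potential _               = 1

potential-drop : ∀ b ι → potential (new (act b ι)) < potential (old (act b ι))
potential-drop _     (inc false _)   = s≤s (s≤s z≤n)
potential-drop _     (inc true  _)   = s≤s (s≤s z≤n)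
potential-drop false (dec _ _ _)     = s≤s z≤n
potential-drop true  (dec false _ _) = s≤s z≤n
potential-drop true  (dec true  _ _) = s≤s z≤n

-- `rest` counts the tokens that keep their label. Splitting `count` exposes the successor on which
-- a decrement matches; in a zero test neither `free` nor `used` contributes to a counter.
exec-act : ∀ b ι {q} {count rest : Label → ℕ}
  → (∀ z → absent (act b ι) ≡ just z → count z ≡ 0)
  → (∀ ℓ → δ ℓ (old (act b ι)) + rest ℓ ≡ count ℓ)
  → exec ι ⟨ q , count (token false) , count (token true) ⟩
    ≡ ⟨ target (act b ι) , δ (token false) (new (act b ι)) + rest (token false)
                         , δ (token true)  (new (act b ι)) + rest (token true) ⟩
exec-act _     (inc false j)    none eq rewrite sym (eq (token false)) | sym (eq (token true)) = refl
exec-act _     (inc true  j)    none eq rewrite sym (eq (token false)) | sym (eq (token true)) = refl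
exec-act false (dec false j j′) none eq
  rewrite eq (token false) | eq (token true) | none _ refl = refl
exec-act false (dec true  j j′) none eq
  rewrite eq (token false) | eq (token true) | none _ refl = refl
exec-act true  (dec false j j′) none eq rewrite sym (eq (token false)) | sym (eq (token true)) = refl
exec-act true  (dec true  j j′) none eq rewrite sym (eq (token false)) | sym (eq (token true)) = refl

-- A positive decrement takes a counter token and every other action a free one, so the machine is
-- never stuck while a free token remains.
act-enabled : ∀ ι (count : Label → ℕ) → 0 < count free
  → ∃ λ b → (∀ z → absent (act b ι) ≡ just z → count z ≡ 0) × 0 < count (old (act b ι))
act-enabled (inc c j) count lt = false , (λ _ ()) , lt
act-enabled (dec c j j′) count lt with count (token c) in eq
... | zero  = false , (λ { _ refl → eq }) , lt
... | suc _ = true , (λ _ ()) , subst (0 <_) (sym eq) (s≤s z≤n)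

-- The formula

-- A token of the current block carries the pair (cur , out); the pair (prv , inn)
-- points to the token of the previous block which it continues.
pattern cur = zero
pattern out = suc zero
pattern prv = suc (suc zero)
pattern inn = suc (suc (suc zero))

forest : Forest 4
forest .parent cur = nothing
forest .parent out = just cur
forest .parent prv = nothing
forest .parent inn = just prv
forest .parent-lt out _ refl = s≤s z≤n
forest .parent-lt inn _ refl = s≤s (s≤s (s≤s z≤n))

module _ {k n : ℕ} where

  infixr 5 _⇒_

  _⇒_ : PForm k n → PForm k n → PForm k n
  φ ⇒ ψ = ¬ᶠ (φ ∧ (¬ᶠ ψ))

  lit : Bool → Fin k → PForm k n
  lit true  p = prop p
  lit false p = ¬ᶠ prop p

module _ {k n : ℕ} where

  ⊤ᶠ : PForm (suc k) n
  ⊤ᶠ = prop zero ⇒ prop zero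

  G : PForm (suc k) n → PForm (suc k) n
  G φ = ¬ᶠ (⊤ᶠ U (¬ᶠ φ))

  ⋀ : ∀ {m} → (Fin m → PForm (suc k) n) → PForm (suc k) n
  ⋀ {zero}  φ = ⊤ᶠ
  ⋀ {suc m} φ = φ zero ∧ ⋀ (φ ∘ suc)

  ⋀ᵇ ⋁ᵇ : (Bool → PForm (suc k) n) → PForm (suc k) n
  ⋀ᵇ φ = φ false ∧ φ true
  ⋁ᵇ φ = ¬ᶠ ((¬ᶠ φ false) ∧ (¬ᶠ φ true))

module _ {k n : ℕ} where

  ⊤ᶜ : CForm k (suc n)
  ⊤ᶜ = ¬ᶜ (at zero ∧ᶜ (¬ᶜ at zero))

  before : (x y : Fin (suc n)) → PForm k (suc n)
  before x y = C -1ℤ x (at y)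

  -- The shift by -1 makes the comparison strict: a position is never matched with itself.
  earlier : (x y : Fin (suc n)) → PForm k (suc n) → PForm k (suc n)
  earlier x y φ = C -1ℤ x (⊤ᶜ S⁼ (at y ∧ᶜ pos φ))

  -- The only future class modality of the encoding; it enters through `lossless` alone, which keeps
  -- the infinite case in the fragment.
  later : (x y : Fin (suc n)) → PForm k (suc n)
  later x y = C 0ℤ x (⊤ᶜ U⁼ at y)

modeBit : ∀ {m} → Bool → ℕ → Fin (suc m) → Bool
modeBit r j zero    = r
modeBit r j (suc l) = toℕ l ≡ᵇ j

module Encoding (P : Program) where

  K : ℕ
  K = 4 + length P

  Form : Set
  Form = PForm K 4

  -- st marks the first position of a block; mode zero tells restart blocks from
  -- blocks reached by a machine step, mode (suc l) says that the program counter is l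
  -- (all false: halted).
  pattern st = zero
  pattern bit₀ = suc zero
  pattern bit₁ = suc (suc zero)
  pattern mode z = suc (suc (suc z))

  label : Label → Form
  label (u , v) = lit u bit₀ ∧ lit v bit₁

  modeIs : Bool → ℕ → Form
  modeIs r j = ⋀ (λ z → lit (modeBit r j z) (mode z))

  keepsMode : Form
  keepsMode = ⋀ (λ z → ⋀ᵇ λ v → lit v (mode z) ⇒ Y (lit v (mode z)))

  -- As a result `cur` determines the block and `prv` names the block just before, so a pair (`prv`
  -- , `inn`) can match a pair (`cur` , `out`) only there.
  blockIds : Form
  blockIds = (prop st ⇒ (¬ᶠ earlier cur cur ⊤ᶠ) ∧ before prv cur)
           ∧ (lit false st ⇒ before cur cur ∧ (before prv prv ∧ keepsMode))

  continues : Form → Form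
  continues = earlier inn out

  change : Label → Label → Form
  change ℓ ℓ′ = label ℓ′ ∧ continues (label ℓ)

  -- Meant for the first position of a new block: `Y` moves to the last token of the previous block
  -- and `S` runs back to a block start. The negation is repeated on the right because `S` does not
  -- test its left argument at the witness.
  lacks : Maybe Label → Form
  lacks nothing  = ⊤ᶠ
  lacks (just z) = Y ((¬ᶠ label z) S (prop st ∧ (¬ᶠ label z)))

  effect : Action → Form
  effect a = lacks (absent a) ∧ (modeIs false (target a) ∧ change (old a) (new a))

  restarted : Form
  restarted = label free ∧ continues ⊤ᶠ

  inside : Form
  inside = (lit true (mode zero) ⇒ restarted)
         ∧ (lit false (mode zero) ⇒ ⋀ᵇ λ u → ⋀ᵇ λ v → label (u , v) ⇒ continues (label (u , v)))

  transition : Form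
  transition = (⋀ (λ l → Y (lit false (mode (suc l)))) ⇒ modeIs true 0 ∧ restarted)
             ∧ ⋀ (λ l → Y (lit true (mode (suc l))) ⇒ ⋁ᵇ λ b → effect (act b (lookup P l)))

  -- The first conjunct makes the pointers into the previous block injective, which is why blocks
  -- never grow.
  tokens : Form
  tokens = (¬ᶠ earlier inn inn ⊤ᶠ) ∧ ((lit false st ⇒ inside) ∧ (prop st ⇒ transition))

  -- Distinct `out` pairs force distinct tokens to have distinct successors. Halted blocks need no
  -- successors, so a finite word may end with one.
  lossless : Form
  lossless = (¬ᶠ earlier out out ⊤ᶠ) ∧ ⋀ (λ l → lit true (mode (suc l)) ⇒ later out inn)

  -- The first block is a mere supply of tokens: it counts as halted, so that a restart follows, and
  -- the token conditions begin only with the second block. Whatever looks one position back is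
  -- placed under `X`, as position 0 has no predecessor.
  spec : Form → Form
  spec extra = ⋀ (λ l → lit false (mode (suc l)))
             ∧ (X (G blockIds) ∧ X (lit false st U (prop st ∧ G (tokens ∧ extra))))

-- Meaning of the formulas

InW-down : ∀ ℓ {i j} → j ≤ i → InW ℓ i → InW ℓ j
InW-down (fin m) j≤i i<m = ≤-<-trans j≤i i<m
InW-down inf     _   _   = tt

InW? : ∀ ℓ i → Dec (InW ℓ i)
InW? (fin m) i = i <? m
InW? inf     i = yes tt

shift-0 : ∀ i → shift i 0ℤ ≡ just i
shift-0 i = cong just (+-identityʳ i)

module Meaning (P : Program) {Δ : Set} (w : Word Δ (4 + length P) 4) where
  open Encoding P
  open Semantics forest w public

  W : ℕ → Set
  W = InW (len w)

  -- The connectives ⇒, ⋁ᵇ and G are encoded by negations, hence the double negation.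
  record _⊩_≋_ (i : ℕ) (φ : Form) (A : Set) : Set where
    constructor _⇄_
    field
      to   : i ⊨ φ → ¬ ¬ A
      from : A → i ⊨ φ

  open _⊩_≋_ public

  ≋-∧ : ∀ {i φ ψ A B} → i ⊩ φ ≋ A → i ⊩ ψ ≋ B → i ⊩ φ ∧ ψ ≋ (A × B)
  ≋-∧ f g = (λ (s , t) k → f .to s λ a → g .to t λ b → k (a , b)) ⇄ λ (a , b) → f .from a , g .from b

  ≋-¬ : ∀ {i φ A} → i ⊩ φ ≋ A → i ⊩ ¬ᶠ φ ≋ (¬ A)
  ≋-¬ f = (λ ¬s k → k (¬s ∘ f .from)) ⇄ λ ¬a s → f .to s ¬a

  ≋-⇒ : ∀ {i φ ψ A B} → i ⊩ φ ≋ A → i ⊩ ψ ≋ B → i ⊩ φ ⇒ ψ ≋ (A → B)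
  ≋-⇒ f g = (λ h k → k λ a → ⊥-elim (h (f .from a , λ t → g .to t λ b → k λ _ → b)))
          ⇄ λ h (s , ¬t) → f .to s λ a → ¬t (g .from (h a))

  ≋-⋁ᵇ : ∀ {i} {φ : Bool → Form} {A : Bool → Set} → (∀ b → i ⊩ φ b ≋ A b) → i ⊩ ⋁ᵇ φ ≋ ∃ A
  ≋-⋁ᵇ f = (λ h k → h ((λ s → f false .to s λ a → k (false , a)) , λ s → f true .to s λ a → k (true , a)))
         ⇄ λ { (false , a) (h , _) → h (f false .from a) ; (true , a) (_ , h) → h (f true .from a) }

  ≋-⋀ᵇ : ∀ {i} {φ : Bool → Form} {A : Bool → Set} → (∀ b → i ⊩ φ b ≋ A b) → i ⊩ ⋀ᵇ φ ≋ (∀ b → A b)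
  ≋-⋀ᵇ f = (λ (s , t) k → f false .to s λ a → f true .to t λ b → k λ { false → a ; true → b })
         ⇄ λ h → f false .from (h false) , f true .from (h true)

  lab-≋ : ∀ v {i p} → i ⊩ lit v p ≋ (lab w i p ≡ v)
  lab-≋ true  = (λ eq k → k eq) ⇄ λ eq → eq
  lab-≋ false {i} {p} = (λ h k → k (¬-not h)) ⇄ λ eq eq′ → true≢false (trans (sym eq′) eq)

  labels : ℕ → Label
  labels i = lab w i bit₀ , lab w i bit₁

  label-≋ : ∀ ℓ {i} → i ⊩ label ℓ ≋ (labels i ≡ ℓ)
  label-≋ (u , v) {i} =
      (λ (s , t) k → lab-≋ u .to s λ eq → lab-≋ v .to t λ eq′ → k (cong₂ _,_ eq eq′))
    ⇄ λ eq → lab-≋ u .from (cong proj₁ eq) , lab-≋ v .from (cong proj₂ eq)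

  ⊤ᶠ-holds : ∀ {i} → i ⊨ ⊤ᶠ
  ⊤ᶠ-holds (s , ¬s) = ¬s s

  ⊤-≋ : ∀ {i} → i ⊩ ⊤ᶠ ≋ ⊤
  ⊤-≋ = (λ _ k → k tt) ⇄ λ _ → ⊤ᶠ-holds

  ⋀-≋ : ∀ {m} (φ : Fin m → Form) {i} {A : Fin m → Set}
    → (∀ z → i ⊩ φ z ≋ A z) → i ⊩ ⋀ φ ≋ (∀ z → A z)
  ⋀-≋ {zero}  φ f = (λ _ k → k λ ()) ⇄ λ _ → ⊤ᶠ-holds
  ⋀-≋ {suc m} φ f =
      (λ (s , t) k → f zero .to s λ a → ⋀-≋ (φ ∘ suc) (f ∘ suc) .to t λ b → k λ { zero → a ; (suc z) → b z })
    ⇄ λ h → f zero .from (h zero) , ⋀-≋ (φ ∘ suc) (f ∘ suc) .from (h ∘ suc)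

  Y-≋ : ∀ {φ i A} → i ⊩ φ ≋ A → suc i ⊩ Y φ ≋ A
  Y-≋ f = (λ { (_ , refl , s) → f .to s }) ⇄ λ a → _ , refl , f .from a

  before-≋ : ∀ {x y i} → W (suc i) → suc i ⊩ before x y ≋ (vec i y ≡ vec (suc i) x)
  before-≋ {i = i} wi = (λ { (_ , refl , _ , eq) k → k eq })
                      ⇄ λ eq → i , refl , InW-down (len w) (n≤1+n i) wi , eq

  Earlier : Fin 4 → Fin 4 → (ℕ → Set) → ℕ → Set
  Earlier x y A i = ∃ λ j → j ≤ i × vec j y ≡ vec (suc i) x × A j

  earlier-≋ : ∀ {x y i φ A} → W (suc i) → (∀ j → j ⊩ φ ≋ A j) → suc i ⊩ earlier x y φ ≋ Earlier x y A i
  earlier-≋ {y = y} {i} wi f =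
      (λ { (_ , refl , _ , j , j≤i , _ , (eq , s) , _) k → f j .to s λ a → k (j , j≤i , eq , a) })
    ⇄ λ (j , j≤i , eq , a) →
        i , refl , InW-down (len w) (n≤1+n i) wi , j , j≤i
      , (InW-down (len w) (m≤n⇒m≤1+n j≤i) wi , y , eq) , (eq , f j .from a)
      , λ _ _ _ _ (s , ¬s) → ¬s s

  Later : Fin 4 → Fin 4 → ℕ → Set
  Later x y i = ∃ λ j → i ≤ j × W j × vec j y ≡ vec i x

  later-≋ : ∀ {x y i} → W i → i ⊩ later x y ≋ Later x y i
  later-≋ {x} {y} {i} wi =
      (λ (i′ , eq′ , _ , j , i′≤j , (wj , _) , eq , _) k →
         k (j , subst (_≤ j) (just-injective (trans (sym eq′) (shift-0 i))) i′≤j , wj , eq))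
    ⇄ λ (j , i≤j , wj , eq) →
        i , shift-0 i , wi , j , i≤j , (wj , y , eq) , eq , λ _ _ _ _ (s , ¬s) → ¬s s

  G-to : ∀ {φ i j} → i ⊨ G φ → i ≤ j → W j → ¬ ¬ (j ⊨ φ)
  G-to g i≤j wj ¬s = g (_ , i≤j , wj , ¬s , λ _ _ _ → ⊤ᶠ-holds)

  G-from : ∀ {φ i} → (∀ j → i ≤ j → W j → j ⊨ φ) → i ⊨ G φ
  G-from h (j , i≤j , wj , ¬s , _) = ¬s (h j i≤j wj)

  Mode : Bool → ℕ → ℕ → Set
  Mode r j i = ∀ z → lab w i (mode z) ≡ modeBit r j z

  -- In the predicates below, the argument i stands for the position suc i.

  BlockIds : ℕ → Set
  BlockIds i =
      (lab w (suc i) st ≡ true → ¬ Earlier cur cur (λ _ → ⊤) i × vec i cur ≡ vec (suc i) prv)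
    × (lab w (suc i) st ≡ false → vec i cur ≡ vec (suc i) cur × vec i prv ≡ vec (suc i) prv
        × (∀ z v → lab w (suc i) (mode z) ≡ v → lab w i (mode z) ≡ v))

  blockIds-≋ : ∀ {i} → W (suc i) → suc i ⊩ blockIds ≋ BlockIds i
  blockIds-≋ wi = ≋-∧
    (≋-⇒ (lab-≋ true) (≋-∧ (≋-¬ (earlier-≋ wi λ _ → ⊤-≋)) (before-≋ wi)))
    (≋-⇒ (lab-≋ false) (≋-∧ (before-≋ wi) (≋-∧ (before-≋ wi)
      (⋀-≋ _ λ z → ≋-⋀ᵇ λ v → ≋-⇒ (lab-≋ v) (Y-≋ (lab-≋ v))))))

  Continues : (ℕ → Set) → ℕ → Set
  Continues = Earlier inn out

  Restarted : ℕ → Set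
  Restarted i = labels (suc i) ≡ free × Continues (λ _ → ⊤) i

  restarted-≋ : ∀ {i} → W (suc i) → suc i ⊩ restarted ≋ Restarted i
  restarted-≋ wi = ≋-∧ (label-≋ free) (earlier-≋ wi λ _ → ⊤-≋)

  Lacks : Maybe Label → ℕ → Set
  Lacks nothing  i = ⊤
  Lacks (just z) i = ∃ λ j → j ≤ i × lab w j st ≡ true × (∀ j′ → j ≤ j′ → j′ ≤ i → labels j′ ≢ z)

  lacks-≋ : ∀ m {i} → suc i ⊩ lacks m ≋ Lacks m i
  lacks-≋ nothing  = ⊤-≋
  lacks-≋ (just z) {i} = Y-≋
    ( (λ (j , j≤i , (s , ¬l) , h) k → k (j , j≤i , s , λ j′ j≤j′ j′≤i eq →
         absurd j ¬l h j′ j≤j′ j′≤i (label-≋ z .from eq)))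
    ⇄ λ (j , j≤i , s , h) → j , j≤i , (s , λ l → label-≋ z .to l (h j ≤-refl j≤i))
      , λ j′ j<j′ j′≤i l → label-≋ z .to l (h j′ (<⇒≤ j<j′) j′≤i))
    where
    absurd : ∀ j → ¬ (j ⊨ label z) → (∀ j′ → j < j′ → j′ ≤ i → ¬ (j′ ⊨ label z))
      → ∀ j′ → j ≤ j′ → j′ ≤ i → ¬ (j′ ⊨ label z)
    absurd j ¬l h j′ j≤j′ j′≤i l with m≤n⇒m<n∨m≡n j≤j′
    ... | inj₁ j<j′ = h j′ j<j′ j′≤i l
    ... | inj₂ refl = ¬l l

  Effect : Action → ℕ → Set
  Effect a i = Lacks (absent a) i × Mode false (target a) (suc i)
             × labels (suc i) ≡ new a × Continues (λ j → labels j ≡ old a) i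

  effect-≋ : ∀ a {i} → W (suc i) → suc i ⊩ effect a ≋ Effect a i
  effect-≋ a wi = ≋-∧ (lacks-≋ (absent a)) (≋-∧ (⋀-≋ _ λ z → lab-≋ (modeBit false (target a) z))
    (≋-∧ (label-≋ (new a)) (earlier-≋ wi λ _ → label-≋ (old a))))

  Inside : ℕ → Set
  Inside i =
      (lab w (suc i) (mode zero) ≡ true → Restarted i)
    × (lab w (suc i) (mode zero) ≡ false →
        ∀ u v → labels (suc i) ≡ (u , v) → Continues (λ j → labels j ≡ (u , v)) i)

  Transition : ℕ → Set
  Transition i =
      ((∀ l → lab w i (mode (suc l)) ≡ false) → Mode true 0 (suc i) × Restarted i)
    × (∀ l → lab w i (mode (suc l)) ≡ true → ∃ λ b → Effect (act b (lookup P l)) i)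

  Tokens : ℕ → Set
  Tokens i = ¬ Earlier inn inn (λ _ → ⊤) i
    × (lab w (suc i) st ≡ false → Inside i) × (lab w (suc i) st ≡ true → Transition i)

  tokens-≋ : ∀ {i} → W (suc i) → suc i ⊩ tokens ≋ Tokens i
  tokens-≋ wi = ≋-∧ (≋-¬ (earlier-≋ wi λ _ → ⊤-≋)) (≋-∧
    (≋-⇒ (lab-≋ false) (≋-∧ (≋-⇒ (lab-≋ true) (restarted-≋ wi))
      (≋-⇒ (lab-≋ false) (≋-⋀ᵇ λ u → ≋-⋀ᵇ λ v →
        ≋-⇒ (label-≋ (u , v)) (earlier-≋ {inn} {out} wi λ _ → label-≋ (u , v))))))
    (≋-⇒ (lab-≋ true) (≋-∧
      (≋-⇒ (⋀-≋ _ λ l → Y-≋ (lab-≋ false)) (≋-∧ (⋀-≋ _ λ z → lab-≋ (modeBit true 0 z)) (restarted-≋ wi)))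
      (⋀-≋ _ λ l → ≋-⇒ (Y-≋ (lab-≋ true)) (≋-⋁ᵇ λ b → effect-≋ (act b (lookup P l)) wi)))))

  Lossless : ℕ → Set
  Lossless i = ¬ Earlier out out (λ _ → ⊤) i
    × (∀ l → lab w (suc i) (mode (suc l)) ≡ true → Later out inn (suc i))

  lossless-≋ : ∀ {i} → W (suc i) → suc i ⊩ lossless ≋ Lossless i
  lossless-≋ wi = ≋-∧ (≋-¬ (earlier-≋ wi λ _ → ⊤-≋)) (⋀-≋ _ λ l → ≋-⇒ (lab-≋ true) (later-≋ wi))

-- From models to halting runs

-- Constructively, double negation passes through a quantifier only when this is bounded; therefore
-- each later argument inspects just a finite prefix of the word.
¬¬-bounded : ∀ M {Q : ℕ → Set} → (∀ i → i < M → ¬ ¬ Q i) → ¬ ¬ (∀ i → i < M → Q i)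
¬¬-bounded zero    h k = k λ _ ()
¬¬-bounded (suc M) h k = ¬¬-bounded M (λ i i<M → h i (m≤n⇒m≤1+n i<M)) λ qs → h M ≤-refl λ q →
  k λ i i<1+M → case-≤ qs q (m≤n⇒m<n∨m≡n (s≤s⁻¹ i<1+M))
  where
  case-≤ : ∀ {Q : ℕ → Set} → (∀ i → i < M → Q i) → Q M → ∀ {i} → i < M ⊎ i ≡ M → Q i
  case-≤ qs q (inj₁ i<M) = qs _ i<M
  case-≤ qs q (inj₂ refl) = q

split : ∀ {p i} → p ≤ i → ∃ λ o → i ≡ o + p
split p≤i = _ , sym (m∸n+n≡m p≤i)

halted⇒nth : ∀ (P : Program) q → (∀ (l : Fin (length P)) → (toℕ l ≡ᵇ q) ≡ false) → nth P q ≡ nothing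
halted⇒nth []      q       h = refl
halted⇒nth (ι ∷ P) zero    h = ⊥-elim (true≢false (h zero))
halted⇒nth (ι ∷ P) (suc q) h = halted⇒nth P q (h ∘ suc)

nth-lookup : ∀ (P : Program) q (l : Fin (length P)) → (toℕ l ≡ᵇ q) ≡ true → nth P q ≡ just (lookup P l)
nth-lookup (ι ∷ P) zero    zero    _ = refl
nth-lookup (ι ∷ P) (suc q) (suc l) h = nth-lookup P q l h

run-suc : ∀ P t c → run P (suc t) c ≡ step P (run P t c)
run-suc P zero    c = refl
run-suc P (suc t) c = run-suc P t (step P c)

step-exec : ∀ P c {ι} → nth P (Config.pc c) ≡ just ι → step P c ≡ exec ι c
step-exec P c eq with nth P (Config.pc c) | eq
... | just _ | refl = refl

potential≤2 : ∀ ℓ → potential ℓ ≤ 2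
potential≤2 (false , false) = ≤-refl
potential≤2 (false , true)  = s≤s z≤n
potential≤2 (true  , false) = s≤s z≤n
potential≤2 (true  , true)  = z≤n

-- When nothing is lost, the inequalities for the indicator of ℓ and for its complement
-- add up to an equality.
exact-count : ∀ {a b ℓ₀} {f f′ : ℕ → Label} → a ≤ b
  → (∀ (g : Label → ℕ) → g ℓ₀ + ∑ b (g ∘ f′) ≤ ∑ (suc a) (g ∘ f))
  → ∀ ℓ → δ ℓ ℓ₀ + ∑ b (δ ℓ ∘ f′) ≡ ∑ (suc a) (δ ℓ ∘ f)
exact-count {a} {b} {ℓ₀} {f} {f′} a≤b bound ℓ = ≤-antisym (bound (δ ℓ)) (+-cancelʳ-≤ r y x (begin
  y + r    ≤⟨ +-monoʳ-≤ y (bound δ̄) ⟩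
  y + y̅    ≡⟨ total (suc a) f ⟩
  suc a    ≤⟨ s≤s a≤b ⟩
  suc b    ≡⟨ sym (total (suc b) (λ { zero → ℓ₀ ; (suc o) → f′ o })) ⟩
  x + r    ∎))
  where
  open ≤-Reasoning
  δ̄ : Label → ℕ
  δ̄ ℓ′ = 1 ∸ δ ℓ ℓ′
  x = δ ℓ ℓ₀ + ∑ b (δ ℓ ∘ f′)
  r = δ̄ ℓ₀ + ∑ b (δ̄ ∘ f′)
  y = ∑ (suc a) (δ ℓ ∘ f)
  y̅ = ∑ (suc a) (δ̄ ∘ f)
  total : ∀ m (e : ℕ → Label) → ∑ m (δ ℓ ∘ e) + ∑ m (δ̄ ∘ e) ≡ m
  total m e = trans (∑-+ m _ _) (trans (∑-cong m λ o _ → m+[n∸m]≡n (δ≤1 ℓ (e o)))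
                (∑-one m))

init : Config
init = ⟨ 0 , 0 , 0 ⟩

-- Comparison of two consecutive blocks

module Blocks (P : Program) {Δ : Set} (w : Word Δ (4 + length P) 4) where
  open Encoding P
  open Meaning P w

  -- Positions p , … , a + p lie in one block if p starts it.
  Stretch : ℕ → ℕ → Set
  Stretch p a = ∀ o → o < a → lab w (suc (o + p)) st ≡ false

  -- Position 0 opens the first block whether or not `st` holds there.
  Head : ℕ → Set
  Head p = p ≡ 0 ⊎ lab w p st ≡ true

  pair-cur : ∀ {i j} → vec j out ≡ vec i inn → vec j cur ≡ vec i prv
  pair-cur eq = cong Data.List.[_] (∷-injectiveˡ eq)

  -- Relates the block from `p` to `a + p` to the next `suc b` tokens, which need not be a complete
  -- block. The last field of `machine` states the injection of tokens for all weights at once: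
  -- `const 1` yields sizes, `potential` the descent, and `δ` the label counts.
  data Follow (p a b : ℕ) : Set where
    restart : (∀ l → lab w p (mode (suc l)) ≡ false)
            → Mode true 0 (suc (a + p))
            → (∀ o → o ≤ b → labels (o + suc (a + p)) ≡ free)
            → b ≤ a
            → Follow p a b
    machine : ∀ l β → (let α = act β (lookup P l))
            → lab w p (mode (suc l)) ≡ true
            → (∀ z → absent α ≡ just z → ∀ o → o ≤ a → labels (o + p) ≢ z)
            → Mode false (target α) (suc (a + p))
            → labels (suc (a + p)) ≡ new α
            → (∀ (g : Label → ℕ) → g (old α) + ∑ b (λ o → g (labels (suc (o + suc (a + p)))))
                                   ≤ ∑ (suc a) (λ o → g (labels (o + p))))
            → Follow p a b

  follow-≤ : ∀ {p a b} → Follow p a b → b ≤ a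
  follow-≤ (restart _ _ _ b≤a) = b≤a
  follow-≤ {a = a} {b} (machine _ _ _ _ _ _ bound) =
    s≤s⁻¹ (subst₂ _≤_ (∑-one (suc b)) (∑-one (suc a)) (bound (const 1)))

  -- `H` delimits the part of the word where the conditions are available without double negation: a
  -- prefix when two blocks are compared, or an entire finite word.
  module Ids (H : ℕ → Set) (H-down : ∀ {i j} → j ≤ i → H i → H j)
             (ids : ∀ i → H (suc i) → BlockIds i) where

    stretch-const : ∀ {p a} → Stretch p a → H (a + p) → ∀ o → o ≤ a
      → vec (o + p) cur ≡ vec p cur × vec (o + p) prv ≡ vec p prv
        × (∀ z → lab w (o + p) (mode z) ≡ lab w p (mode z))
    stretch-const str h zero    _   = refl , refl , λ _ → refl
    stretch-const {p} str h (suc o) o<a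
      with stretch-const str h o (<⇒≤ o<a)
         | ids (o + p) (H-down (+-monoˡ-≤ p o<a) h) .proj₂ (str o o<a)
    ... | c , e , m | c′ , e′ , m′ = trans (sym c′) c , trans (sym e′) e , λ z → trans (sym (m′ z _ refl)) (m z)

    fresh : ∀ {p j} → Head p → H p → j < p → vec j cur ≢ vec p cur
    fresh {zero}  _ _ () _
    fresh {suc p} (inj₂ s) h (s≤s j≤p) eq = ids p h .proj₁ s .proj₁ (_ , j≤p , eq , tt)

    link : ∀ {i} → H (suc i) → lab w (suc i) st ≡ true → vec (suc i) prv ≡ vec i cur
    link h s = sym (ids _ h .proj₁ s .proj₂)

  module Consecutive
    (H : ℕ → Set) (H-down : ∀ {i j} → j ≤ i → H i → H j)
    (ids : ∀ i → H (suc i) → BlockIds i)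
    {n : ℕ} (toks : ∀ i → n ≤ i → H (suc i) → Tokens i)
    {p a b : ℕ} (hd : Head p) (str : Stretch p a)
    (n≤ : n ≤ a + p) (stq : lab w (suc (a + p)) st ≡ true)
    (str′ : Stretch (suc (a + p)) b) (h : H (b + suc (a + p)))
    where
    open Ids H H-down ids

    q : ℕ
    q = suc (a + p)

    hq : H q
    hq = H-down (m≤n+m q b) h

    h-p : H (a + p)
    h-p = H-down (n≤1+n _) hq

    n<q+ : ∀ o → n ≤ o + q
    n<q+ o = ≤-trans n≤ (≤-trans (n≤1+n _) (m≤n+m q o))

    -- The identifier of `j` must be that of the block at `p`. From `q` on the identifier is a new
    -- one, and before `p` it is excluded by freshness at `p`.
    locate : ∀ {o j} → o ≤ b → j < o + q → vec j out ≡ vec (o + q) inn → ∃ λ t → t ≤ a × j ≡ t + p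
    locate {o} {j} o≤b j<o+q eq with j <? q
    ... | no j≮q with split (≮⇒≥ j≮q)
    ...   | t , refl = ⊥-elim (fresh (inj₂ stq) hq ≤-refl (begin
          vec (a + p) cur ≡⟨ sym (link hq stq) ⟩
          vec q prv       ≡⟨ sym (stretch-const str′ h o o≤b .proj₂ .proj₁) ⟩
          vec (o + q) prv ≡⟨ sym (pair-cur eq) ⟩
          vec (t + q) cur ≡⟨ stretch-const str′ h t (≤-trans (<⇒≤ (+-cancelʳ-< q t o j<o+q)) o≤b) .proj₁ ⟩
          vec q cur       ∎))
          where open ≡-Reasoning
    locate {o} {j} o≤b j<o+q eq | yes j<q with j <? p
    ... | yes j<p = ⊥-elim (fresh hd (H-down (m≤n+m p a) h-p) j<p (begin
          vec j cur       ≡⟨ pair-cur eq ⟩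
          vec (o + q) prv ≡⟨ stretch-const str′ h o o≤b .proj₂ .proj₁ ⟩
          vec q prv       ≡⟨ link hq stq ⟩
          vec (a + p) cur ≡⟨ stretch-const str h-p a ≤-refl .proj₁ ⟩
          vec p cur       ∎))
          where open ≡-Reasoning
    ... | no j≮p with split (≮⇒≥ j≮p)
    ...   | t , refl = t , +-cancelʳ-≤ p t a (s≤s⁻¹ j<q) , refl

    R : ℕ → ℕ → Set
    R i j = vec (j + p) out ≡ vec (i + q) inn

    inn-distinct : ∀ {i i′} → i < i′ → i′ < suc b → vec (i + q) inn ≢ vec (i′ + q) inn
    inn-distinct {i} {suc i′} (s≤s i≤i′) i′<b eq =
      toks (i′ + q) (n<q+ i′) (H-down (+-monoˡ-≤ q (s≤s⁻¹ i′<b)) h) .proj₁ (_ , +-monoˡ-≤ q i≤i′ , eq , tt)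

    R-injective : ∀ {i i′ j} → i < suc b → i′ < suc b → R i j → R i′ j → i ≡ i′
    R-injective {i} {i′} i<b i′<b r r′ with <-cmp i i′
    ... | tri< i<i′ _ _ = ⊥-elim (inn-distinct i<i′ i′<b (trans (sym r) r′))
    ... | tri≈ _ eq _   = eq
    ... | tri> _ _ i>i′ = ⊥-elim (inn-distinct i>i′ i<b (trans (sym r′) r))

    transition-q : Transition (a + p)
    transition-q = toks (a + p) n≤ hq .proj₂ .proj₂ stq

    inside-q : ∀ o → o < b → Inside (o + q)
    inside-q o o<b = toks (o + q) (n<q+ o) (H-down (+-monoˡ-≤ q o<b) h) .proj₂ .proj₁ (str′ o o<b)

    mode-q′ : ∀ z → lab w (a + p) (mode z) ≡ lab w p (mode z)
    mode-q′ = stretch-const str h-p a ≤-refl .proj₂ .proj₂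

    mode-inside : ∀ o → o < b → ∀ z → lab w (suc (o + q)) (mode z) ≡ lab w q (mode z)
    mode-inside o o<b = stretch-const str′ h (suc o) o<b .proj₂ .proj₂

    target-of : ∀ {o A i} → o ≤ b → o + q ≡ suc i → Continues A i → ∃ λ t → t < suc a × R o t × A (t + p)
    target-of {o} {A} {i} o≤b eq (j , j≤i , r , x) with locate o≤b (subst (j <_) (sym eq) (s≤s j≤i)) (subst (λ k → vec j out ≡ vec k inn) (sym eq) r)
    ... | t , t≤a , refl = t , s≤s t≤a , subst (λ k → vec j out ≡ vec k inn) (sym eq) r , x

    follow : Follow p a b
    follow with any? (λ l → lab w p (mode (suc l)) Bool.≟ true)
    ... | no none = restart off mode-q free-labels (s≤s⁻¹ (subst₂ _≤_ (∑-one (suc b)) (∑-one (suc a)) le))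
      where
      off : ∀ l → lab w p (mode (suc l)) ≡ false
      off l = ¬-not (λ eq → none (l , eq))

      restarted-q : Mode true 0 q × Restarted (a + p)
      restarted-q = transition-q .proj₁ λ l → trans (mode-q′ (suc l)) (off l)

      mode-q : Mode true 0 q
      mode-q = restarted-q .proj₁

      restarted-inside : ∀ o → o < b → Restarted (o + q)
      restarted-inside o o<b = inside-q o o<b .proj₁ (trans (mode-inside o o<b zero) (mode-q zero))

      free-labels : ∀ o → o ≤ b → labels (o + q) ≡ free
      free-labels zero    _   = restarted-q .proj₂ .proj₁
      free-labels (suc o) o<b = restarted-inside o o<b .proj₁

      total : ∀ i → i < suc b → ∃ λ j → j < suc a × R i j × 1 ≤ 1
      total zero i<b with target-of z≤n refl (restarted-q .proj₂ .proj₂)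
      ... | t , t<a , r , _ = t , t<a , r , ≤-refl
      total (suc o) (s≤s o<b) with target-of o<b refl (restarted-inside o o<b .proj₂)
      ... | t , t<a , r , _ = t , t<a , r , ≤-refl

      le : ∑ (suc b) (const 1) ≤ ∑ (suc a) (const 1)
      le = ∑-injection (suc b) (suc a) R total R-injective
    ... | yes (l , on) with transition-q .proj₂ l (trans (mode-q′ (suc l)) on)
    ...   | β , lacking , mode-q , new-q , cont = machine l β on lacks-z mode-q new-q bound
      where
      α : Action
      α = act β (lookup P l)

      lacks-z : ∀ z → absent α ≡ just z → ∀ o → o ≤ a → labels (o + p) ≢ z
      lacks-z z eq o o≤a with subst (λ m → Lacks m (a + p)) eq lacking
      -- The formula only gives absence since some block start `j`. No block starts after `p` within
      -- the stretch, so `j ≤ p` and the whole block is covered.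
      ... | j , j≤ , s , none with p <? j
      ...   | no p≮j = none (o + p) (≤-trans (≮⇒≥ p≮j) (m≤n+m p o)) (+-monoˡ-≤ p o≤a)
      ...   | yes p<j with split p<j
      ...     | t , refl = ⊥-elim (true≢false (trans (sym s)
                  (subst (λ i → lab w i st ≡ false) (sym (+-suc t p))
                    (str t (+-cancelʳ-≤ p (suc t) a (subst (_≤ a + p) (+-suc t p) j≤))))))

      bound : ∀ (g : Label → ℕ) → g (old α) + ∑ b (λ o → g (labels (suc (o + q))))
                                  ≤ ∑ (suc a) (λ o → g (labels (o + p)))
      bound g = ∑-injection (suc b) (suc a) {h = source} R total R-injective
        where
        source : ℕ → ℕ
        -- The first token counts with the label it had before the step, which is the label of the
        -- token it points to.
        source zero    = g (old α)
        source (suc o) = g (labels (suc (o + q)))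

        total : ∀ i → i < suc b → ∃ λ j → j < suc a × R i j × source i ≤ g (labels (j + p))
        total zero i<b with target-of z≤n refl cont
        ... | t , t<a , r , eq = t , t<a , r , ≤-reflexive (cong g (sym eq))
        total (suc o) (s≤s o<b) with target-of o<b refl
          (inside-q o o<b .proj₂ (trans (mode-inside o o<b zero) (mode-q zero)) _ _ refl)
        ... | t , t<a , r , eq = t , t<a , r , ≤-reflexive (cong g (sym eq))

-- Descent of the potential and faithful rounds

module Loops (P : Program) {Δ : Set} (w : Word Δ (4 + length P) 4) (n : ℕ)
  (ids  : ∀ i → InW (len w) (suc i) → ¬ ¬ Meaning.BlockIds P w i)
  (toks : ∀ i → n ≤ i → InW (len w) (suc i) → ¬ ¬ Meaning.Tokens P w i)
  where
  open Encoding P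
  open Meaning P w
  open Blocks P w

  W-down : ∀ {i j} → j ≤ i → W i → W j
  W-down = InW-down (len w)

  follow : ∀ {p a b} → Head p → Stretch p a → n ≤ a + p → lab w (suc (a + p)) st ≡ true
    → Stretch (suc (a + p)) b → W (b + suc (a + p)) → ¬ ¬ Follow p a b
  follow {p} {a} {b} hd str n≤ stq str′ wr k =
    ¬¬-bounded (b + suc (a + p)) (λ i i<M → ids i (W-down i<M wr)) λ ids′ →
    ¬¬-bounded (b + suc (a + p)) (λ i i<M ¬t → toks′ i (W-down i<M wr) ¬t) λ toks″ →
    k (Consecutive.follow (_≤ b + suc (a + p)) ≤-trans (λ i lt → ids′ i lt)
         (λ i n≤i lt → toks″ i lt n≤i) hd str n≤ stq str′ ≤-refl)
    where
    toks′ : ∀ i → W (suc i) → ¬ ¬ (n ≤ i → Tokens i)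
    toks′ i wi ¬t with n ≤? i
    ... | yes n≤i = toks i n≤i wi λ t → ¬t λ _ → t
    ... | no  n≰i = ¬t λ n≤i → ⊥-elim (n≰i n≤i)

  count : Label → ℕ → ℕ → ℕ
  count ℓ p a = ∑ (suc a) (λ o → δ ℓ (labels (o + p)))

  weight : ℕ → ℕ → ℕ
  weight p a = ∑ (suc a) (λ o → potential (labels (o + p)))

  weight-≤ : ∀ p a → weight p a ≤ suc a * 2
  weight-≤ p a = ≤-trans (∑-mono (suc a) λ o → potential≤2 (labels (o + p))) (≤-reflexive (∑-const (suc a) 2))

  weight-drop : ∀ {p a b} l β → (let α = act β (lookup P l)) → labels (suc (a + p)) ≡ new α
    → potential (old α) + ∑ b (λ o → potential (labels (suc (o + suc (a + p))))) ≤ weight p a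
    → weight (suc (a + p)) b < weight p a
  weight-drop l β eq le rewrite eq = <-≤-trans (+-monoˡ-< _ (potential-drop β (lookup P l))) le

  record Simulates (p a : ℕ) (c : Config) : Set where
    field
      at-pc : ∀ l → lab w p (mode (suc l)) ≡ (toℕ l ≡ᵇ Config.pc c)
      at-c₀ : count (token false) p a ≡ Config.c₀ c
      at-c₁ : count (token true) p a ≡ Config.c₁ c

  open Simulates

  simulates-init : ∀ {p a} → Mode true 0 p → (∀ o → o ≤ a → labels (o + p) ≡ free) → Simulates p a init
  simulates-init m f .at-pc l = m (suc l)
  simulates-init {a = a} m f .at-c₀ = ∑-zero (suc a) λ o o≤a → cong (δ (token false)) (f o (s≤s⁻¹ o≤a))
  simulates-init {a = a} m f .at-c₁ = ∑-zero (suc a) λ o o≤a → cong (δ (token true)) (f o (s≤s⁻¹ o≤a))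

  -- With `a ≤ b` no token is lost, so `exact-count` turns the inequalities of `Follow` into
  -- equalities, and `exec-act` reads them as a machine step.
  simulates-step : ∀ {p a b c} l β → (let α = act β (lookup P l)) → Simulates p a c
    → lab w p (mode (suc l)) ≡ true
    → (∀ z → absent α ≡ just z → ∀ o → o ≤ a → labels (o + p) ≢ z)
    → Mode false (target α) (suc (a + p))
    → labels (suc (a + p)) ≡ new α
    → (∀ (g : Label → ℕ) → g (old α) + ∑ b (λ o → g (labels (suc (o + suc (a + p)))))
                           ≤ ∑ (suc a) (λ o → g (labels (o + p))))
    → a ≤ b → Simulates (suc (a + p)) b (step P c)
  simulates-step {p} {a} {b} {⟨ pc , c₀ , c₁ ⟩} l β sim on none m eq bound a≤b =
    subst (Simulates (suc (a + p)) b) (sym stepped) record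
      { at-pc = λ l → m (suc l)
      ; at-c₀ = cong (λ ℓ → δ (token false) ℓ + _) eq
      ; at-c₁ = cong (λ ℓ → δ (token true) ℓ + _) eq
      }
    where
    α = act β (lookup P l)
    rest : Label → ℕ
    rest ℓ = ∑ b (λ o → δ ℓ (labels (suc (o + suc (a + p)))))
    stepped : step P ⟨ pc , c₀ , c₁ ⟩
            ≡ ⟨ target α , δ (token false) (new α) + rest (token false) , δ (token true) (new α) + rest (token true) ⟩
    stepped = trans
      (step-exec P _ (nth-lookup P pc l (trans (sym (sim .at-pc l)) on)))
      (trans (cong₂ (λ x y → exec (lookup P l) ⟨ pc , x , y ⟩) (sym (sim .at-c₀)) (sym (sim .at-c₁)))
        (exec-act β (lookup P l) {count = λ ℓ → count ℓ p a} {rest = rest}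
          (λ z e → ∑-zero (suc a) λ o o≤a → δ-≢ (none z e o (s≤s⁻¹ o≤a)))
          (exact-count {f = λ o → labels (o + p)} a≤b bound)))

  -- Shared by finite and infinite words. A successor block is demanded only of running blocks,
  -- because a finite word may stop at a halted one.
  module Exact (bound : ℕ) (running : ∀ t → t ≤ bound → nth P (Config.pc (run P t init)) ≢ nothing)
    (Good : ℕ → ℕ → Set)
    (advance : ∀ {p a} → Good p a → ∀ l → lab w p (mode (suc l)) ≡ true
             → ¬ ¬ (∃ λ b → Good (suc (a + p)) b × Follow p a b))
    where

    -- A block which simulates the run either passes this on to the next block or loses tokens;
    -- the former happens only finitely often since the potential drops.
    exact : ∀ fuel {p a t} → (∀ {p b} → Good p b → b < a → ⊥) → Good p a
      → Simulates p a (run P t init) → t + weight p a ≤ bound → weight p a < fuel → ⊥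
    exact (suc fuel) {p} {a} {t} loss good sim le lt with any? (λ l → lab w p (mode (suc l)) Bool.≟ true)
    ... | no none = running t (≤-trans (m≤m+n t _) le) (halted⇒nth P _ λ l →
            trans (sym (sim .at-pc l)) (¬-not λ eq → none (l , eq)))
    ... | yes (l , on) = advance good l on λ (b , good′ , fol) → next b good′ fol
      where
      next : ∀ b → Good (suc (a + p)) b → Follow p a b → ⊥
      next b good′ (restart off _ _ _) = true≢false (trans (sym on) (off l))
      next b good′ fol@(machine l′ β on′ none m eq bd) with m≤n⇒m<n∨m≡n (follow-≤ fol)
      ... | inj₁ b<a = loss good′ b<a
      ... | inj₂ refl = exact fuel {t = suc t} loss good′
              (subst (Simulates _ b) (sym (run-suc P t init)) (simulates-step l′ β sim on′ none m eq bd ≤-refl))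
              -- A step adds one to `t` and takes at least one from the weight, so their sum stays
              -- within `bound`.
              (≤-trans (subst (_≤ t + weight p a) (+-suc t _) (+-monoʳ-≤ t drop)) le)
              (<-≤-trans drop (s≤s⁻¹ lt))
        where
        drop : weight (suc (a + p)) b < weight p a
        drop = weight-drop {b = b} l′ β eq (bd potential)

  -- The first block has `suc n` tokens, later ones have no more, and each has potential at most 2.
  bound : ℕ
  bound = suc n * 2

  Running : Set
  Running = ∀ t → t ≤ bound → nth P (Config.pc (run P t init)) ≢ nothing

  -- Infinite words

  module Infinite (everywhere : ∀ i → W i) (running : Running) where

    record Good (p a : ℕ) : Set where
      field
        head    : Head p
        stretch : Stretch p a
        end     : lab w (suc (a + p)) st ≡ true
        late    : n ≤ a + p

    open Good

    next-start : ∀ q m → (∃ λ b → Stretch q b × lab w (suc (b + q)) st ≡ true) ⊎ Stretch q m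
    next-start q zero = inj₂ λ _ ()
    next-start q (suc m) with next-start q m
    ... | inj₁ found = inj₁ found
    ... | inj₂ str with lab w (suc (m + q)) st in eq
    ...   | true  = inj₁ (m , str , eq)
    ...   | false = inj₂ λ o o≤m → extend (m≤n⇒m<n∨m≡n (s≤s⁻¹ o≤m))
      where
      extend : ∀ {o} → o < m ⊎ o ≡ m → lab w (suc (o + q)) st ≡ false
      extend (inj₁ o<m)  = str _ o<m
      extend (inj₂ refl) = eq

    -- The next block must end in time: a stretch of `suc a` further positions without a start would
    -- have more tokens than the block before it.
    advance : ∀ {p a} → Good p a → ¬ ¬ (∃ λ b → Good (suc (a + p)) b × Follow p a b)
    advance {p} {a} g k with next-start (suc (a + p)) (suc a)
    ... | inj₁ (b , str , e) = follow (g .head) (g .stretch) (g .late) (g .end) str (everywhere _) λ fol →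
            k (b , record { head = inj₂ (g .end) ; stretch = str ; end = e
                          ; late = ≤-trans (g .late) (≤-trans (n≤1+n _) (m≤n+m _ b)) } , fol)
    ... | inj₂ str = follow (g .head) (g .stretch) (g .late) (g .end) str (everywhere _) λ fol →
            1+n≰n (follow-≤ fol)

    open Exact bound running Good (λ g _ _ → advance g)

    -- After a loss the simulation is broken, but the weight still drops at every machine step. So a
    -- restart comes, and its block is still shorter than `m`.
    lossy : ∀ fuel {m p a} → (∀ {p b} → Good p b → Simulates p b init → b < m → ⊥)
      → Good p a → a < m → weight p a < fuel → ⊥
    lossy (suc fuel) {m} {p} {a} again good a<m lt = advance good λ (b , good′ , fol) → next b good′ fol
      where
      next : ∀ b → Good (suc (a + p)) b → Follow p a b → ⊥
      next b good′ (restart _ md fr b≤a) = again good′ (simulates-init md fr) (≤-<-trans b≤a a<m)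
      next b good′ fol@(machine l β _ _ _ eq bd) =
        lossy fuel again good′ (≤-<-trans (follow-≤ fol) a<m)
          (<-≤-trans (weight-drop {b = b} l β eq (bd potential)) (s≤s⁻¹ lt))

    -- Induction on the block size: a round without loss would halt within `bound`, and a loss leads
    -- through `lossy` to a restart with a shorter block.
    no-start : ∀ m {p a} → m ≤ suc n → Good p a → Simulates p a init → a < m → ⊥
    no-start (suc m) {p} {a} m≤n good sim (s≤s a≤m) = exact (suc (weight p a)) {t = 0}
      (λ {p′} {b} good′ b<a → lossy (suc (weight p′ b)) (no-start m (<⇒≤ m≤n)) good′ (<-≤-trans b<a a≤m) ≤-refl)
      good sim (≤-trans (weight-≤ p a) (*-monoˡ-≤ 2 (≤-trans (s≤s a≤m) m≤n))) ≤-refl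

    refute : Good 0 n → (∀ l → lab w 0 (mode (suc l)) ≡ false) → ⊥
    refute good off = advance good λ
      { (b , good′ , restart _ md fr b≤n)       → no-start (suc n) ≤-refl good′ (simulates-init md fr) (s≤s b≤n)
      ; (b , good′ , machine l _ on _ _ _ _) → true≢false (trans (sym on) (off l)) }

  -- Finite words

  module Finite (m : ℕ) (W⇒< : ∀ {i} → W i → i < m) (running : Running)
    (ids′ : ∀ i → W (suc i) → BlockIds i)
    (loss : ∀ i → n ≤ i → W (suc i) → Lossless i) where

    open Ids W W-down ids′

    successor : ∀ {i} → n < i → W i → ∀ l → lab w i (mode (suc l)) ≡ true → Later out inn i
    successor (s≤s n≤i) wi = loss _ n≤i wi .proj₂

    out-distinct : ∀ {i j} → n < i → W i → j < i → vec j out ≢ vec i out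
    out-distinct (s≤s n≤i) wi (s≤s j≤i) eq = loss _ n≤i wi .proj₁ (_ , j≤i , eq , tt)

    record Good (p a : ℕ) : Set where
      field
        start   : lab w p st ≡ true
        stretch : Stretch p a
        word    : W (a + p)
        end     : lab w (suc (a + p)) st ≡ true ⊎ ¬ W (suc (a + p))
        late    : n < p

    open Good

    next-end : ∀ q fuel → W q
      → (∃ λ b → Stretch q b × W (b + q) × (lab w (suc (b + q)) st ≡ true ⊎ ¬ W (suc (b + q))))
        ⊎ (Stretch q fuel × W (fuel + q))
    next-end q zero wq = inj₂ ((λ _ ()) , wq)
    next-end q (suc m) wq with next-end q m wq
    ... | inj₁ found = inj₁ found
    ... | inj₂ (str , wm) with InW? (len w) (suc (m + q))
    ...   | no ¬w = inj₁ (m , str , wm , inj₂ ¬w)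
    ...   | yes w′ with lab w (suc (m + q)) st in eq
    ...     | true  = inj₁ (m , str , wm , inj₁ eq)
    ...     | false = inj₂ ((λ o o≤m → extend (m≤n⇒m<n∨m≡n (s≤s⁻¹ o≤m))) , w′)
      where
      extend : ∀ {o} → o < m ⊎ o ≡ m → lab w (suc (o + q)) st ≡ false
      extend (inj₁ o<m)  = str _ o<m
      extend (inj₂ refl) = eq

    good-at : ∀ q → n < q → W q → lab w q st ≡ true → ∃ (Good q)
    good-at q n<q wq s with next-end q m wq
    ... | inj₁ (b , str , wb , e) = b , record { start = s ; stretch = str ; word = wb ; end = e ; late = n<q }
    ... | inj₂ (_ , wm) = ⊥-elim (m+n≮m m q (W⇒< wm))

    module Successors {p a : ℕ} (g : Good p a) (l : Fin (length P)) (on : lab w p (mode (suc l)) ≡ true) where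

      -- The successor has the identifier of this block as its `prv`, whereas the positions of the
      -- block itself carry an older identifier there; so it lies beyond the block.
      successor-inn : ∀ {o} → o ≤ a → ∃ λ i → W i × suc (a + p) ≤ i
        × vec i inn ≡ vec (o + p) out × vec i prv ≡ vec p cur
      successor-inn {o} o≤a with successor (≤-trans (g .late) (m≤n+m p o)) (W-down (+-monoˡ-≤ p o≤a) (g .word)) l
             (trans (stretch-const (g .stretch) (g .word) o o≤a .proj₂ .proj₂ (suc l)) on)
      ... | i , o+p≤i , wi , eq = i , wi , ≰⇒> i≰ , eq , prv-i
        where
        prv-i : vec i prv ≡ vec p cur
        prv-i = trans (sym (pair-cur (sym eq))) (stretch-const (g .stretch) (g .word) o o≤a .proj₁)
        own-prv : ∀ {p} → n < p → W p → lab w p st ≡ true → vec p prv ≢ vec p cur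
        own-prv (s≤s _) wp s eq = fresh (inj₂ s) wp ≤-refl (trans (sym (link wp s)) eq)
        i≰ : ¬ (i ≤ a + p)
        i≰ i≤ with split (≤-trans (m≤n+m p o) o+p≤i)
        ... | t , refl = own-prv (g .late) (W-down (m≤n+m p a) (g .word)) (g .start)
              (trans (sym (stretch-const (g .stretch) (g .word) t (+-cancelʳ-≤ p t a i≤) .proj₂ .proj₁)) prv-i)

      next-word : W (suc (a + p))
      next-word with successor-inn {0} z≤n
      ... | _ , wi , q≤i , _ = W-down q≤i wi

      next-start : lab w (suc (a + p)) st ≡ true
      next-start with g .end
      ... | inj₁ s  = s
      ... | inj₂ ¬w = ⊥-elim (¬w next-word)

      q : ℕ
      q = suc (a + p)

      cur-after : ∀ d → W (d + q) → vec p cur ≢ vec (d + q) cur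
      cur-after zero    wd eq = fresh (inj₂ next-start) wd (s≤s (m≤n+m p a)) eq
      cur-after (suc d) wd eq with lab w (suc (d + q)) st in s
      ... | true  = fresh (inj₂ s) wd (s≤s (≤-trans (m≤n+m p a) (≤-trans (n≤1+n _) (m≤n+m q d)))) eq
      ... | false = cur-after d (W-down (n≤1+n _) wd) (trans eq (sym (ids′ (d + q) wd .proj₂ s .proj₁)))

      -- After the block at `q`, every `prv` copies the `cur` of some position from `q` on, and
      -- `cur-after` separates these from the `cur` of `p`.
      prv-after : ∀ {b} → lab w (suc (b + q)) st ≡ true → ∀ d → W (d + suc (b + q))
        → vec (d + suc (b + q)) prv ≢ vec p cur
      prv-after {b} s zero wd eq = cur-after b (W-down (n≤1+n _) wd) (trans (sym eq) (link wd s))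
      prv-after {b} s (suc d) wd eq with lab w (suc (d + suc (b + q))) st in s′
      ... | true  = cur-after (d + suc b) (subst W (sym assoc) (W-down (n≤1+n _) wd))
                      (trans (sym eq) (trans (link wd s′) (cong (λ i → vec i cur) (sym assoc))))
        where
        assoc : d + suc b + q ≡ d + suc (b + q)
        assoc = +-assoc d (suc b) q
      ... | false = prv-after s d (W-down (n≤1+n _) wd) (trans (ids′ _ wd .proj₂ s′ .proj₂ .proj₁) eq)

      -- All successors fall into the block at `q`: not earlier by `successor-inn`, not later by
      -- `prv-after`. Distinct `out` pairs make the assignment injective, giving the converse of
      -- `follow-≤`.
      no-loss : ∀ {b} → Good q b → a ≤ b
      no-loss {b} g′ = s≤s⁻¹ (subst₂ _≤_ (∑-one (suc a)) (∑-one (suc b))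
        (∑-injection (suc a) (suc b) (λ o t → vec (t + q) inn ≡ vec (o + p) out) total
          λ i<a i′<a r r′ → inj (<-cmp _ _) i<a i′<a (trans (sym r) r′)))
        where
        total : ∀ o → o < suc a → ∃ λ t → t < suc b × vec (t + q) inn ≡ vec (o + p) out × 1 ≤ 1
        total o (s≤s o≤a) with successor-inn o≤a
        ... | i , wi , q≤i , r , prv-i with split q≤i
        ...   | t , refl with t ≤? b
        ...     | yes t≤b = t , s≤s t≤b , r , ≤-refl
        ...     | no t≰b with g′ .end
        ...       | inj₂ ¬w = ⊥-elim (¬w (W-down (+-monoˡ-≤ q (≰⇒> t≰b)) wi))
        ...       | inj₁ s with split (+-monoˡ-≤ q (≰⇒> t≰b))
        ...         | d , eq = ⊥-elim (prv-after s d (subst W eq wi) (subst (λ i → vec i prv ≡ vec p cur) eq prv-i))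

        distinct : ∀ {i i′} → i < i′ → i′ < suc a → vec (i + p) out ≢ vec (i′ + p) out
        distinct {i} {i′} i<i′ (s≤s i′≤a) = out-distinct (≤-trans (g .late) (m≤n+m p i′))
          (W-down (+-monoˡ-≤ p i′≤a) (g .word)) (+-monoˡ-< p i<i′)

        inj : ∀ {i i′} → Tri (i < i′) (i ≡ i′) (i′ < i) → i < suc a → i′ < suc a
          → vec (i + p) out ≡ vec (i′ + p) out → i ≡ i′
        inj (tri< lt _ _) _   i′<a eq = ⊥-elim (distinct lt i′<a eq)
        inj (tri≈ _ i≡ _) _   _    _  = i≡
        inj (tri> _ _ gt) i<a _    eq = ⊥-elim (distinct gt i<a (sym eq))

    module _ (s : ℕ) where

      -- With `s` the size of the restart block, the lower bound contradicts the loss case of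
      -- `exact` at once.
      Large : ℕ → ℕ → Set
      Large p a = Good p a × s ≤ a

      advance : ∀ {p a} → Large p a → ∀ l → lab w p (mode (suc l)) ≡ true
        → ¬ ¬ (∃ λ b → Large (suc (a + p)) b × Follow p a b)
      advance {p} {a} (g , s≤a) l on k
        with good-at (suc (a + p)) (m≤n⇒m≤1+n (≤-trans (g .late) (m≤n+m p a))) (Successors.next-word g l on) (Successors.next-start g l on)
      ... | b , g′ = follow (inj₂ (g .start)) (g .stretch) (<⇒≤ (≤-trans (g .late) (m≤n+m p a)))
              (Successors.next-start g l on) (g′ .stretch) (g′ .word) λ fol →
              k (b , (g′ , ≤-trans s≤a (Successors.no-loss g l on g′)) , fol)

      no-start : ∀ {p} → s ≤ n → Good p s → Simulates p s init → ⊥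
      no-start {p} s≤n g sim = Exact.exact bound running Large advance (suc (weight p s)) {t = 0}
        (λ (_ , s≤b) b<s → <⇒≱ b<s s≤b) (g , ≤-refl) sim
        (≤-trans (weight-≤ p s) (*-monoˡ-≤ 2 (s≤s s≤n))) ≤-refl

    refute : Stretch 0 n → lab w (suc n) st ≡ true → W (suc n) → (∀ l → lab w 0 (mode (suc l)) ≡ false) → ⊥
    refute str s wn off with good-at (suc (n + 0)) (s≤s (m≤m+n n 0)) (subst W eq wn) s′
      where
      eq : suc n ≡ suc (n + 0)
      eq = cong suc (sym (+-identityʳ n))
      s′ : lab w (suc (n + 0)) st ≡ true
      s′ = subst (λ i → lab w i st ≡ true) eq s
    ... | b , g = follow (inj₁ refl) str (m≤m+n n 0) (g .start) (g .stretch) (g .word) λ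
      { (restart _ md fr b≤n)       → no-start b b≤n g (simulates-init md fr)
      ; (machine l _ on _ _ _ _) → true≢false (trans (sym on) (off l)) }

-- From halting runs to models

-- For `x ≤ t`, the permutation of 0, ..., `t` that brings `x` to the front: offset `o` of a block
-- points to offset `σ x o` of the previous one.
σ : ℕ → ℕ → ℕ
σ x zero    = x
σ x (suc o) = punch x o

σ-≤ : ∀ {x o t} → x ≤ t → o ≤ t → σ x o ≤ t
σ-≤ {o = zero}  x≤t _   = x≤t
σ-≤ {x} {suc o} x≤t o<t = punch-≤ x o<t

σ-injective : ∀ x {o o′} → σ x o ≡ σ x o′ → o ≡ o′
σ-injective x {zero}  {zero}   eq = refl
σ-injective x {zero}  {suc o′} eq = ⊥-elim (punch-≢ x o′ (sym eq))
σ-injective x {suc o} {zero}   eq = ⊥-elim (punch-≢ x o eq)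
σ-injective x {suc o} {suc o′} eq = cong suc (punch-injective x eq)

σ-surjective : ∀ {x y t} → x ≤ t → y ≤ t → ∃ λ o → o ≤ t × σ x o ≡ y
σ-surjective {x} {y} x≤t y≤t with y ≟ x
... | yes refl = 0 , z≤n , refl
... | no y≢x with punch-surjective x x≤t y≤t y≢x
...   | o , o<t , eq = suc o , o<t , eq

-- The halting run as an endless sequence of blocks of `suc t` tokens

module Stages (P : Program) (t : ℕ) where

  count : Label → (ℕ → Label) → ℕ
  count ℓ e = ∑ (suc t) (δ ℓ ∘ e)

  -- `left` is a number of steps that suffices for halting. A step spends at most one free token, so
  -- `enough` is preserved and no step lacks a token.
  record Stage : Set where
    field
      restarts : Bool
      config   : Config
      content  : ℕ → Label
      changed  : ℕ
      changed≤ : changed ≤ t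
      has-c₀   : count (token false) content ≡ Config.c₀ config
      has-c₁   : count (token true) content ≡ Config.c₁ config
      left     : ℕ
      halts    : nth P (Config.pc (run P left config)) ≡ nothing
      enough   : left ≤ count free content

  open Stage public

  pc-of : Stage → ℕ
  pc-of s = Config.pc (config s)

  data Trans (s s′ : Stage) : Set where
    restart : nth P (pc-of s) ≡ nothing → restarts s′ ≡ true → pc-of s′ ≡ 0
            → (∀ o → content s′ o ≡ free) → Trans s s′
    machine : ∀ ι β → (let α = act β ι)
            → nth P (pc-of s) ≡ just ι
            → (∀ z → absent α ≡ just z → ∀ o → o ≤ t → content s o ≢ z)
            → restarts s′ ≡ false → pc-of s′ ≡ target α
            → content s (changed s′) ≡ old α
            → content s′ 0 ≡ new α
            → (∀ o → content s′ (suc o) ≡ content s (punch (changed s′) o))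
            → left s ≡ suc (left s′)
            → Trans s s′

  blank : ∀ r c m → Config.c₀ c ≡ 0 → Config.c₁ c ≡ 0 → nth P (Config.pc (run P m c)) ≡ nothing → m ≤ t → Stage
  blank r c m z₀ z₁ h m≤t = record
    { restarts = r ; config = c ; content = const free ; changed = 0 ; changed≤ = z≤n
    ; has-c₀ = trans (∑-zero (suc t) λ _ _ → refl) (sym z₀)
    ; has-c₁ = trans (∑-zero (suc t) λ _ _ → refl) (sym z₁)
    ; left = m ; halts = h
    ; enough = ≤-trans (m≤n⇒m≤1+n m≤t) (≤-reflexive (sym (∑-one (suc t)))) }

  module _ (halt : nth P (Config.pc (run P t init)) ≡ nothing) where

    step-stage : ∀ s ι → nth P (pc-of s) ≡ just ι → Σ Stage (Trans s)
    step-stage s ι is-ι with left s in eq-left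
    ... | zero = ⊥-elim (nothing≢just (trans (sym (subst (λ m → nth P (Config.pc (run P m (config s))) ≡ nothing) eq-left (halts s))) is-ι))
    ... | suc m with act-enabled ι (λ ℓ → count ℓ (content s)) (<-≤-trans (subst (0 <_) (sym eq-left) (s≤s z≤n)) (enough s))
    ...   | β , none , some with ∑-positive (suc t) _ some
    ...     | x , s≤s x≤t , at-x = s′ , machine ι β is-ι lacking refl (cong Config.pc executed) old-x refl (λ _ → refl) eq-left
      where
      α : Action
      α = act β ι

      old-x : content s x ≡ old α
      old-x = δ-positive (old α) (content s x) at-x

      rest : Label → ℕ
      rest ℓ = ∑ t (λ o → δ ℓ (content s (punch x o)))

      removed : ∀ ℓ → δ ℓ (old α) + rest ℓ ≡ count ℓ (content s)
      removed ℓ = trans (cong (λ ℓ′ → δ ℓ ℓ′ + rest ℓ) (sym old-x)) (sym (∑-remove (λ o → δ ℓ (content s o)) x≤t))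

      content′ : ℕ → Label
      content′ zero    = new α
      content′ (suc o) = content s (punch x o)

      executed : step P (config s) ≡ ⟨ target α , count (token false) content′ , count (token true) content′ ⟩
      executed = trans (step-exec P _ is-ι)
        (trans (cong₂ (λ y z → exec ι ⟨ pc-of s , y , z ⟩) (sym (has-c₀ s)) (sym (has-c₁ s)))
          (exec-act β ι {count = λ ℓ → count ℓ (content s)} {rest = rest} none removed))

      lacking : ∀ z → absent α ≡ just z → ∀ o → o ≤ t → content s o ≢ z
      lacking z e o o≤t refl = 1+n≰n (begin
        1                     ≡⟨ sym (δ-refl z) ⟩
        δ z (content s o)     ≤⟨ term≤∑ (λ o → δ z (content s o)) (s≤s o≤t) ⟩
        count z (content s)   ≡⟨ none z e ⟩
        0                     ∎)
        where open ≤-Reasoning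

      s′ : Stage
      s′ = record
        { restarts = false ; config = step P (config s) ; content = content′ ; changed = x ; changed≤ = x≤t
        ; has-c₀ = cong Config.c₀ (sym executed) ; has-c₁ = cong Config.c₁ (sym executed)
        ; left = m
        ; halts = subst (λ m → nth P (Config.pc (run P m (config s))) ≡ nothing) eq-left (halts s)
        ; enough = s≤s⁻¹ (begin
            suc m                      ≡⟨ sym eq-left ⟩
            left s                     ≤⟨ enough s ⟩
            count free (content s)     ≡⟨ sym (removed free) ⟩
            δ free (old α) + rest free ≤⟨ +-monoˡ-≤ _ (δ≤1 free (old α)) ⟩
            suc (rest free)            ≤⟨ s≤s (m≤n+m _ (δ free (new α))) ⟩
            suc (count free content′)  ∎) }
        where open ≤-Reasoning

    next-stage : ∀ s → Σ Stage (Trans s)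
    next-stage s with nth P (pc-of s) in eq
    ... | nothing = blank true init t refl refl halt ≤-refl , restart eq refl refl (λ _ → refl)
    ... | just ι  = step-stage s ι eq

    nth-length : ∀ (Q : Program) → nth Q (length Q) ≡ nothing
    nth-length []      = refl
    nth-length (_ ∷ Q) = nth-length Q

    stage : ℕ → Stage
    -- The program counter `length P` lies just outside the program, so the first block counts as
    -- halted.
    stage zero    = blank false ⟨ length P , 0 , 0 ⟩ 0 refl refl (nth-length P) z≤n
    stage (suc k) = next-stage (stage k) .proj₁

    stage-trans : ∀ k → Trans (stage k) (stage (suc k))
    stage-trans k = next-stage (stage k) .proj₂

    -- Each machine step lowers `left`. This locates the halted block after which a finite word can
    -- be cut.
    reaches-halt : ∀ m k → left (stage k) ≡ m → ∃ λ d → nth P (pc-of (stage (d + k))) ≡ nothing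
    reaches-halt m k eq with stage-trans k
    ... | restart h _ _ _ = 0 , h
    reaches-halt zero k eq | machine _ _ _ _ _ _ _ _ _ eq′ = ⊥-elim (1+n≢0 (trans (sym eq′) eq))
    reaches-halt (suc m) k eq | machine _ _ _ _ _ _ _ _ _ eq′
      with reaches-halt m (suc k) (suc-injective (trans (sym eq′) eq))
    ... | d , h = suc d , subst (λ j → nth P (pc-of (stage j)) ≡ nothing) (+-suc d k) h

-- Positions as pairs (block , offset), with offsets 0 , … , t.
module Layout (t : ℕ) where

  forward : ℕ × ℕ → ℕ × ℕ
  forward (k , o) with o <? t
  ... | yes _ = k , suc o
  ... | no  _ = suc k , 0

  place : ℕ → ℕ × ℕ
  place zero    = 0 , 0
  place (suc i) = forward (place i)

  blk off : ℕ → ℕ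
  blk = proj₁ ∘ place
  off = proj₂ ∘ place

  off≤ : ∀ i → off i ≤ t
  off≤ zero = z≤n
  off≤ (suc i) with off i <? t
  ... | yes o<t = o<t
  ... | no  _   = z≤n

  next-place : ∀ i → (off i < t × blk (suc i) ≡ blk i × off (suc i) ≡ suc (off i))
                   ⊎ (off i ≡ t × blk (suc i) ≡ suc (blk i) × off (suc i) ≡ 0)
  next-place i with off i <? t
  ... | yes o<t = inj₁ (o<t , refl , refl)
  ... | no  o≮t = inj₂ (≤-antisym (off≤ i) (≮⇒≥ o≮t) , refl , refl)

  position : ∀ k o → o ≤ t → ∃ λ i → blk i ≡ k × off i ≡ o
  position zero    zero    _ = 0 , refl , refl
  position (suc k) zero    _ with position k t ≤-refl
  ... | i , b , e with next-place i
  ...   | inj₁ (o<t , _)     = ⊥-elim (<⇒≢ o<t e)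
  ...   | inj₂ (_ , b′ , e′) = suc i , trans b′ (cong suc b) , e′
  position k (suc o) o<t with position k o (<⇒≤ o<t)
  ... | i , b , e with next-place i
  ...   | inj₁ (_ , b′ , e′) = suc i , trans b′ b , trans e′ (cong suc e)
  ...   | inj₂ (e′ , _)      = ⊥-elim (<⇒≢ o<t (trans (sym e) e′))

  lex : ∀ {j i} → j < i → blk j < blk i ⊎ (blk j ≡ blk i × off j < off i)
  lex {j} {suc i} (s≤s j≤i) with next-place i | m≤n⇒m<n∨m≡n j≤i
  ... | inj₁ (_ , b , e) | inj₂ refl = inj₂ (sym b , ≤-reflexive (sym e))
  ... | inj₂ (_ , b , _) | inj₂ refl = inj₁ (≤-reflexive (sym b))
  ... | inj₁ (_ , b , e) | inj₁ j<i with lex j<i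
  ...   | inj₁ lt       = inj₁ (subst (blk j <_) (sym b) lt)
  ...   | inj₂ (eq , lt) = inj₂ (trans eq (sym b) , subst (off j <_) (sym e) (m≤n⇒m≤1+n lt))
  lex {j} {suc i} (s≤s j≤i) | inj₂ (_ , b , _) | inj₁ j<i with lex j<i
  ...   | inj₁ lt       = inj₁ (subst (blk j <_) (sym b) (m≤n⇒m≤1+n lt))
  ...   | inj₂ (eq , _) = inj₁ (≤-reflexive (trans (cong suc eq) (sym b)))

  blk-mono : ∀ {j i} → j ≤ i → blk j ≤ blk i
  blk-mono j≤i with m≤n⇒m<n∨m≡n j≤i
  ... | inj₂ refl = ≤-refl
  ... | inj₁ j<i with lex j<i
  ...   | inj₁ lt      = <⇒≤ lt
  ...   | inj₂ (eq , _) = ≤-reflexive eq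

  blk-cancel : ∀ {j i} → blk j < blk i → j < i
  blk-cancel lt = ≰⇒> λ i≤j → <⇒≱ lt (blk-mono i≤j)

  place-injective : ∀ {j i} → j < i → blk j ≡ blk i → off j ≢ off i
  place-injective j<i b e with lex j<i
  ... | inj₁ lt       = <⇒≢ lt b
  ... | inj₂ (_ , lt) = <⇒≢ lt e

  first-block : ∀ i → i ≤ t → blk i ≡ 0 × off i ≡ i
  first-block zero    _   = refl , refl
  first-block (suc i) i<t with first-block i (<⇒≤ i<t) | next-place i
  ... | b , e | inj₁ (_ , b′ , e′) = trans b′ b , trans e′ (cong suc e)
  ... | b , e | inj₂ (e′ , _)      = ⊥-elim (<⇒≢ i<t (trans (sym e) e′))

  later-block : ∀ {i} → t ≤ i → 0 < blk (suc i)
  later-block {i} t≤i with lex (s≤s t≤i) | first-block t ≤-refl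
  ... | inj₁ lt       | _     = ≤-<-trans z≤n lt
  ... | inj₂ (_ , lt) | _ , e = ⊥-elim (<⇒≱ lt (subst (off (suc i) ≤_) (sym e) (off≤ (suc i))))

-- The word built from the stages

module Model (P : Program) (t : ℕ) (halt : nth P (Config.pc (run P t init)) ≡ nothing)
  {Δ : Set} (f : ℕ → Δ) (f-injective : ∀ {x y} → f x ≡ f y → x ≡ y) (ℓ : Len) where
  open Encoding P
  open Stages P t
  open Layout t

  Stg : ℕ → Stage
  Stg = stage halt

  bits : Stage → ℕ → Fin K → Bool
  bits s o st       = o ≡ᵇ 0
  bits s o bit₀     = proj₁ (content s o)
  bits s o bit₁     = proj₂ (content s o)
  bits s o (mode z) = modeBit (restarts s) (pc-of s) z

  -- Identifiers are shifted by one, which leaves `f 0` as the `prv` of the first block. The `out`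
  -- values recur in every block, as only pairs with `cur` are compared.
  values : ℕ → ℕ → Fin 4 → Δ
  values k o cur = f (suc k)
  values k o out = f o
  values k o prv = f k
  values k o inn = f (σ (changed (Stg k)) o)

  word : Word Δ K 4
  word = record { len = ℓ ; lab = λ i → bits (Stg (blk i)) (off i) ; dat = λ i → values (blk i) (off i) }

  open Meaning P word

  not-start : ∀ i {o} → off i ≡ suc o → lab word i st ≢ true
  not-start i e s = true≢false (trans (sym s) (cong (_≡ᵇ 0) e))

  starts : ∀ i → off i ≡ 0 → lab word i st ≡ true
  starts i e = cong (_≡ᵇ 0) e

  mode-at : ∀ i {k} → blk i ≡ k → ∀ z → lab word i (mode z) ≡ modeBit (restarts (Stg k)) (pc-of (Stg k)) z
  mode-at i b z = cong (λ k → modeBit (restarts (Stg k)) (pc-of (Stg k)) z) b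

  labels-at : ∀ i {k o} → blk i ≡ k → off i ≡ o → labels i ≡ content (Stg k) o
  labels-at i b e = cong₂ (λ k o → content (Stg k) o) b e

  blockIds-hold : ∀ i → BlockIds i
  blockIds-hold i with next-place i
  ... | inj₁ (_ , b , e) =
      (λ s → ⊥-elim (not-start (suc i) e s))
    , λ _ → cong (λ k → f (suc k) ∷ []) (sym b) , cong (λ k → f k ∷ []) (sym b)
          , λ z _ eq → trans (sym (mode-at (suc i) b z)) eq
  ... | inj₂ (_ , b , e) =
      (λ _ → (λ (j , j≤i , eq , _) → <⇒≢ (≤-<-trans (blk-mono j≤i) (≤-reflexive (sym b)))
                                       (suc-injective (f-injective (∷-injectiveˡ eq))))
           , cong (λ k → f k ∷ []) (sym b))
    , λ s → ⊥-elim (true≢false (trans (sym (starts (suc i) e)) s))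

  predecessor : ∀ {i k} → blk (suc i) ≡ suc k → ∃ λ j → j ≤ i × vec j out ≡ vec (suc i) inn
    × labels j ≡ content (Stg k) (σ (changed (Stg (suc k))) (off (suc i)))
  predecessor {i} {k} b
    with position k (σ (changed (Stg (suc k))) (off (suc i))) (σ-≤ (changed≤ (Stg (suc k))) (off≤ (suc i)))
  ... | j , b′ , e′ =
      j , s≤s⁻¹ (blk-cancel (subst₂ _<_ (sym b′) (sym b) ≤-refl))
    , cong₂ (λ x y → f x ∷ f y ∷ []) (trans (cong suc b′) (sym b))
        (trans e′ (cong (λ k → σ (changed (Stg k)) (off (suc i))) (sym b)))
    , labels-at j b′ e′

  continue : ∀ {i k A} → blk (suc i) ≡ suc k
    → (∀ j → labels j ≡ content (Stg k) (σ (changed (Stg (suc k))) (off (suc i))) → A j) → Continues A i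
  continue b h with predecessor b
  ... | j , j≤i , eq , l = j , j≤i , eq , h j l

  inn-distinct : ∀ i → ¬ Earlier inn inn (λ _ → ⊤) i
  inn-distinct i (j , j≤i , eq , _) = place-injective (s≤s j≤i) b
    (σ-injective (changed (Stg (blk j)))
      (trans (f-injective (∷-injectiveˡ (∷-injectiveʳ eq)))
        (cong (λ k → σ (changed (Stg k)) (off (suc i))) (sym b))))
    where
    b : blk j ≡ blk (suc i)
    b = f-injective (∷-injectiveˡ eq)

  out-distinct : ∀ i → ¬ Earlier out out (λ _ → ⊤) i
  out-distinct i (j , j≤i , eq , _) = place-injective (s≤s j≤i)
    (suc-injective (f-injective (∷-injectiveˡ eq))) (f-injective (∷-injectiveˡ (∷-injectiveʳ eq)))

  Inside-holds : ∀ i k {o} → blk (suc i) ≡ suc k → off (suc i) ≡ suc o → Inside i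
  Inside-holds i k {o} b e with stage-trans halt k
  ... | restart _ r _ fr =
      (λ _ → trans (labels-at (suc i) b e) (fr (suc o)) , continue b λ _ _ → tt)
    , λ r′ → ⊥-elim (true≢false (trans (sym (trans (mode-at (suc i) b zero) r)) r′))
  ... | machine _ _ _ _ r _ _ _ moves _ =
      (λ r′ → ⊥-elim (true≢false (trans (sym r′) (trans (mode-at (suc i) b zero) r))))
    , λ _ u v eq → continue b λ j l → trans l
        (trans (cong (λ o → content (Stg k) (σ (changed (Stg (suc k))) o)) e)
          (trans (sym (moves o)) (trans (sym (labels-at (suc i) b e)) eq)))

  Lacks-intro : ∀ m {i} → (∀ z → m ≡ just z → Lacks (just z) i) → Lacks m i
  Lacks-intro nothing  h = tt
  Lacks-intro (just z) h = h z refl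

  Transition-holds : ∀ i k → blk i ≡ k → blk (suc i) ≡ suc k → off (suc i) ≡ 0 → Transition i
  Transition-holds i k b b′ e with stage-trans halt k
  ... | restart h r pc fr =
      (λ _ → (λ z → trans (mode-at (suc i) b′ z) (cong₂ (λ r q → modeBit r q z) r pc))
           , trans (labels-at (suc i) b′ e) (fr 0) , continue b′ λ _ _ → tt)
    , λ l on → ⊥-elim (nothing≢just (trans (sym h) (nth-lookup P _ l (trans (sym (mode-at i b (suc l))) on))))
  ... | machine ι β is-ι lacking r pc old-x new-0 _ _ =
      (λ none → ⊥-elim (nothing≢just (trans (sym (halted⇒nth P _ λ l → trans (sym (mode-at i b (suc l))) (none l))) is-ι)))
    , λ l on → β , subst (λ ι → Effect (act β ι) i)
        (just-injective (trans (sym is-ι) (nth-lookup P _ l (trans (sym (mode-at i b (suc l))) on))))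
        ( Lacks-intro _ lacks-z
        , (λ z → trans (mode-at (suc i) b′ z) (cong₂ (λ r q → modeBit r q z) r pc))
        , trans (labels-at (suc i) b′ e) new-0
        , continue b′ λ _ l → trans l
            (trans (cong (λ o → content (Stg k) (σ (changed (Stg (suc k))) o)) e) old-x))
    where
    lacks-z : ∀ z → absent (act β ι) ≡ just z → Lacks (just z) i
    lacks-z z eq with position k 0 z≤n
    ... | j , bj , ej =
        j , s≤s⁻¹ (blk-cancel (subst₂ _<_ (sym bj) (sym b′) ≤-refl)) , starts j ej
      , λ j′ j≤j′ j′≤i l → lacking z eq (off j′) (off≤ j′)
          (trans (sym (labels-at j′ (≤-antisym (subst (blk j′ ≤_) b (blk-mono j′≤i))
                                            (subst (_≤ blk j′) bj (blk-mono j≤j′))) refl)) l)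

  tokens-hold : ∀ i → t ≤ i → Tokens i
  tokens-hold i t≤i with next-place i
  ... | inj₁ (_ , b , e) = inn-distinct i
        , (λ _ → Inside-holds i _ (suc-of (later-block t≤i)) e)
        , (λ s → ⊥-elim (not-start (suc i) e s))
    where
    suc-of : ∀ {m} → 0 < m → m ≡ suc (m ∸ 1)
    suc-of (s≤s _) = refl
  ... | inj₂ (_ , b , e) = inn-distinct i
        , (λ s → ⊥-elim (true≢false (trans (sym (starts (suc i) e)) s)))
        , λ _ → Transition-holds i (blk i) refl b e

  -- Since `σ` is onto, every token is pointed to from the next block; the hypothesis keeps that
  -- block inside the word after a running one.
  lossless-hold : (∀ i j → InW ℓ i → nth P (pc-of (Stg (blk i))) ≢ nothing → blk j ≡ suc (blk i) → InW ℓ j)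
    → ∀ i → InW ℓ (suc i) → Lossless i
  lossless-hold room i wi = out-distinct i , λ l on → successor l on
    where
    k = blk (suc i)
    successor : ∀ l → lab word (suc i) (mode (suc l)) ≡ true → Later out inn (suc i)
    successor l on with σ-surjective (changed≤ (Stg (suc k))) (off≤ (suc i))
    ... | o , o≤t , eq with position (suc k) o o≤t
    ...   | j , b , e = j , <⇒≤ (blk-cancel (≤-reflexive (sym b)))
            , room (suc i) j wi (λ h → nothing≢just (trans (sym h) (nth-lookup P _ l on))) b
            , cong₂ (λ x y → f x ∷ f y ∷ []) b
                (trans (cong₂ (λ k o → σ (changed (Stg k)) o) b e) eq)

  spec-holds : ∀ {extra} → InW ℓ (suc t) → (∀ i → InW ℓ (suc i) → suc i ⊨ extra) → 0 ⊨ spec extra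
  spec-holds wt ext =
      ⋀-≋ _ (λ l → lab-≋ false) .from (λ l → <⇒≢ᵇ (toℕ<n l))
    , (w1 , G-from {blockIds} λ { zero () ; (suc j) _ wj → blockIds-≋ wj .from (blockIds-hold j) })
    -- The first block occupies the positions 0, ..., `t`, so the second one starts at `suc t`.
    , (w1 , suc t , s≤s z≤n , wt
      , ( starts (suc t) off-t
        , G-from {tokens ∧ _} λ { zero () ; (suc j) t<j wj → tokens-≋ wj .from (tokens-hold j (s≤s⁻¹ t<j)) , ext j wj })
      , λ { zero () ; (suc j) _ j<t → lab-≋ false {suc j} {st} .from
              (¬-not (not-start (suc j) (first-block (suc j) (s≤s⁻¹ j<t) .proj₂))) })
    where
    w1 : InW ℓ 1
    w1 = InW-down ℓ (s≤s z≤n) wt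

    <⇒≢ᵇ : ∀ {x y} → x < y → (x ≡ᵇ y) ≡ false
    <⇒≢ᵇ {zero}  (s≤s _) = refl
    <⇒≢ᵇ {suc x} (s≤s lt) = <⇒≢ᵇ lt

    off-t : off (suc t) ≡ 0
    off-t with next-place t
    ... | inj₁ (o<t , _) = ⊥-elim (<⇒≢ o<t (first-block t ≤-refl .proj₂))
    ... | inj₂ (_ , _ , e) = e

-- The reductions

module _ {k n : ℕ} where

  ⇒-minus : ∀ {φ ψ : PForm k n} → MinusP φ → MinusP ψ → MinusP (φ ⇒ ψ)
  ⇒-minus a b = ¬ᶠ (a ∧ (¬ᶠ b))

  lit-minus : ∀ v p → MinusP {k} {n} (lit v p)
  lit-minus true  p = prop p
  lit-minus false p = ¬ᶠ prop p

module _ {k n : ℕ} where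

  ⊤-minus : MinusP {suc k} {n} ⊤ᶠ
  ⊤-minus = ⇒-minus (prop zero) (prop zero)

  G-minus : ∀ {φ : PForm (suc k) n} → MinusP φ → MinusP (G φ)
  G-minus a = ¬ᶠ (⊤-minus U (¬ᶠ a))

  ⋀-minus : ∀ {m} {φ : Fin m → PForm (suc k) n} → (∀ z → MinusP (φ z)) → MinusP (⋀ φ)
  ⋀-minus {zero}  a = ⊤-minus
  ⋀-minus {suc m} a = a zero ∧ ⋀-minus (a ∘ suc)

  ⋀ᵇ-minus : ∀ {φ : Bool → PForm (suc k) n} → (∀ b → MinusP (φ b)) → MinusP (⋀ᵇ φ)
  ⋀ᵇ-minus a = a false ∧ a true

  ⋁ᵇ-minus : ∀ {φ : Bool → PForm (suc k) n} → (∀ b → MinusP (φ b)) → MinusP (⋁ᵇ φ)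
  ⋁ᵇ-minus a = ¬ᶠ ((¬ᶠ a false) ∧ (¬ᶠ a true))

module _ {k n : ℕ} where

  before-minus : ∀ {x y} → MinusP {k} {suc n} (before x y)
  before-minus = C -1ℤ _ (at _)

  earlier-minus : ∀ {x y} {φ : PForm k (suc n)} → MinusP φ → MinusP (earlier x y φ)
  earlier-minus a = C -1ℤ _ ((¬ᶜ (at zero ∧ᶜ (¬ᶜ at zero))) S⁼ (at _ ∧ᶜ pos a))

module _ (P : Program) where
  open Encoding P

  label-minus : ∀ ℓ → MinusP (label ℓ)
  label-minus (u , v) = lit-minus u bit₀ ∧ lit-minus v bit₁

  modeIs-minus : ∀ r j → MinusP (modeIs r j)
  modeIs-minus r j = ⋀-minus λ z → lit-minus (modeBit r j z) (mode z)

  blockIds-minus : MinusP blockIds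
  blockIds-minus =
      ⇒-minus (prop st) ((¬ᶠ earlier-minus ⊤-minus) ∧ before-minus)
    ∧ ⇒-minus (lit-minus false st) (before-minus ∧ (before-minus
        ∧ ⋀-minus λ z → ⋀ᵇ-minus λ v → ⇒-minus (lit-minus v (mode z)) (Y (lit-minus v (mode z)))))

  lacks-minus : ∀ m → MinusP (lacks m)
  lacks-minus nothing  = ⊤-minus
  lacks-minus (just z) = Y ((¬ᶠ label-minus z) S (prop st ∧ (¬ᶠ label-minus z)))

  restarted-minus : MinusP restarted
  restarted-minus = label-minus free ∧ earlier-minus ⊤-minus

  effect-minus : ∀ a → MinusP (effect a)
  effect-minus a = lacks-minus (absent a) ∧ (modeIs-minus false (target a)
    ∧ (label-minus (new a) ∧ earlier-minus (label-minus (old a))))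

  tokens-minus : MinusP tokens
  tokens-minus = (¬ᶠ earlier-minus ⊤-minus)
    ∧ (⇒-minus (lit-minus false st)
        ( ⇒-minus (prop _) restarted-minus
        ∧ ⇒-minus (lit-minus false _) (⋀ᵇ-minus λ u → ⋀ᵇ-minus λ v →
            ⇒-minus (label-minus (u , v)) (earlier-minus {x = inn} {y = out} (label-minus (u , v)))))
      ∧ ⇒-minus (prop st)
        ( ⇒-minus (⋀-minus λ l → Y (lit-minus false _)) (modeIs-minus true 0 ∧ restarted-minus)
        ∧ ⋀-minus λ l → ⇒-minus (Y (prop _)) (⋁ᵇ-minus λ b → effect-minus (act b (lookup P l)))))

  spec-minus : ∀ extra → MinusP extra → MinusP (spec extra)
  spec-minus _ a = ⋀-minus (λ l → lit-minus false _)
    ∧ (X (G-minus blockIds-minus) ∧ X (lit-minus false st U (prop st ∧ G-minus (tokens-minus ∧ a))))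

module Reduction (P : Program) where
  open Encoding P

  instance-of : Form → Instance
  instance-of extra = record { nProps = K ; nAttrs = 4 ; order = forest ; formula = spec extra }

  module Spec {Δ : Set} (w : Word Δ K 4) {extra : Form} where
    open Meaning P w
    open Blocks P w

    module Parts (holds : 0 ⊨ spec extra) where

      start-of : ∃ λ p → 1 ≤ p × W p × p ⊨ (prop st ∧ G (tokens ∧ extra)) × (∀ j → 1 ≤ j → j < p → j ⊨ lit false st)
      start-of = holds .proj₂ .proj₂ .proj₂

      n : ℕ
      -- The last position of the first block; the start found is at least 1, so the subtraction is
      -- exact.
      n = start-of .proj₁ ∸ 1

      start≡ : start-of .proj₁ ≡ suc n
      start≡ = sym (m+[n∸m]≡n (start-of .proj₂ .proj₁))

      is-start : lab w (suc n) st ≡ true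
      is-start = subst (λ i → lab w i st ≡ true) start≡ (start-of .proj₂ .proj₂ .proj₂ .proj₁ .proj₁)

      start-W : W (suc n)
      start-W = subst W start≡ (start-of .proj₂ .proj₂ .proj₁)

      ids : ∀ i → W (suc i) → ¬ ¬ BlockIds i
      ids i wi k = G-to {blockIds} (holds .proj₂ .proj₁ .proj₂) (s≤s z≤n) wi λ h → blockIds-≋ wi .to h k

      from-start : ∀ i → n ≤ i → W (suc i) → ¬ ¬ (suc i ⊨ (tokens ∧ extra))
      from-start i n≤i = G-to {tokens ∧ extra} (start-of .proj₂ .proj₂ .proj₂ .proj₁ .proj₂) (subst (_≤ suc i) (sym start≡) (s≤s n≤i))

      toks : ∀ i → n ≤ i → W (suc i) → ¬ ¬ Tokens i
      toks i n≤i wi k = from-start i n≤i wi λ h → tokens-≋ wi .to (h .proj₁) k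

      stretch : Stretch 0 n
      stretch o o<n = ¬-not (start-of .proj₂ .proj₂ .proj₂ .proj₂ (suc (o + 0)) (s≤s z≤n)
        (subst (suc (o + 0) <_) (sym start≡) (s≤s (subst (_< n) (sym (+-identityʳ o)) o<n))))

      off : ¬ ¬ (∀ l → lab w 0 (mode (suc l)) ≡ false)
      off = ⋀-≋ _ (λ l → lab-≋ false) .to (holds .proj₁)

  is-nothing? : ∀ (m : Maybe Instr) → Dec (m ≡ nothing)
  is-nothing? nothing  = yes refl
  is-nothing? (just _) = no λ ()

  -- Halting within a given number of steps is decidable, so that it may be proved by contradiction.
  halts-by : ∀ m → ¬ (∀ t → t ≤ m → nth P (Config.pc (run P t init)) ≢ nothing) → Halts P
  halts-by m ¬running with anyUpTo? (λ t → is-nothing? (nth P (Config.pc (run P t init)))) (suc m)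
  ... | yes (t , _ , h) = t , h
  ... | no none = ⊥-elim (¬running λ t t≤m h → none (t , s≤s t≤m , h))

  module _ {Δ : Set} where

    infinite-sound : SatInf Δ (instance-of ⊤ᶠ) → Halts P
    infinite-sound (w , eq , holds) = halts-by (Loops.bound P w n ids toks) λ running →
      off (Loops.Infinite.refute P w n ids toks everywhere running record
        { head = inj₁ refl ; stretch = stretch
        ; end = subst (λ i → lab w (suc i) st ≡ true) (sym (+-identityʳ n)) is-start
        ; late = m≤m+n n 0 })
      where
      open Spec.Parts w {⊤ᶠ} holds
      everywhere : ∀ i → InW (len w) i
      everywhere i = subst (λ ℓ → InW ℓ i) (sym eq) tt

    finite-sound : SatFin Δ (instance-of lossless) → Halts P
    finite-sound (w , m , eq , holds) = halts-by (Loops.bound P w n ids toks) λ running →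
      off λ off′ →
      ¬¬-bounded (suc m) (λ i _ → ¬¬-→ (ids i)) λ ids′ →
      ¬¬-bounded (suc m) (λ i _ → ¬¬-→ λ n≤i → ¬¬-→ λ wi k →
        from-start i n≤i wi λ h → lossless-≋ wi .to (h .proj₂) k) λ loss →
      Loops.Finite.refute P w n ids toks (suc m) W⇒< running
        (λ i wi → ids′ i (<⇒≤ (W⇒< wi)) wi) (λ i n≤i wi → loss i (<⇒≤ (W⇒< wi)) n≤i wi)
        stretch is-start start-W off′
      where
      open Meaning P w
      open Spec.Parts w {lossless} holds
      W⇒< : ∀ {i} → W i → i < suc m
      W⇒< {i} = subst (λ ℓ → InW ℓ i) eq
      ¬¬-→ : ∀ {A B : Set} → (A → ¬ ¬ B) → ¬ ¬ (A → B)
      ¬¬-→ h k = k λ a → ⊥-elim (h a λ b → k λ _ → b)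

  module _ {Δ : Set} (f : ℕ → Δ) (f-injective : ∀ {x y} → f x ≡ f y → x ≡ y) where

    infinite-complete : Halts P → SatInf Δ (instance-of ⊤ᶠ)
    infinite-complete (t , halt) = word , refl , spec-holds {⊤ᶠ} tt λ i _ → Meaning.⊤ᶠ-holds P word {suc i}
      where open Model P t halt f f-injective inf

    finite-complete : Halts P → SatFin Δ (instance-of lossless)
    finite-complete (t , halt) with Stages.reaches-halt P t halt _ 1 refl
    -- Stage 0 is halted by convention, hence the search from stage 1, the first restart. The word
    -- ends just before the block that follows the halted one.
    ... | d , halted with Layout.position t (suc (d + 1)) 0 z≤n
    ...   | zero  , () , _
    ...   | suc m , b , e = word , m , refl , spec-holds {lossless} t<m λ i wi →
              Meaning.lossless-≋ P word wi .Meaning.from (lossless-hold room i wi)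
      where
      open Layout t
      open Model P t halt f f-injective (fin (suc m))

      t<m : suc t < suc m
      t<m = blk-cancel (subst₂ _<_ (sym blk-t) (sym b) (s≤s (m≤n+m 1 d)))
        where
        blk-t : blk (suc t) ≡ 1
        blk-t with next-place t
        ... | inj₁ (o<t , _)   = ⊥-elim (<⇒≢ o<t (first-block t ≤-refl .proj₂))
        ... | inj₂ (_ , b , _) = trans b (cong suc (first-block t ≤-refl .proj₁))

      -- The last block, number `d + 1`, is halted, so a running block comes before it and its
      -- successor still fits.
      room : ∀ i j → i < suc m → nth P (Config.pc (Stages.config (Stg (blk i)))) ≢ nothing
        → blk j ≡ suc (blk i) → j < suc m
      room i j i<m running bj with lex i<m
      ... | inj₂ (_ , lt) = ⊥-elim (n≮0 (subst (off i <_) e lt))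
      ... | inj₁ lt = blk-cancel (subst₂ _<_ (sym bj) (sym b) (s≤s (≤∧≢⇒< (s≤s⁻¹ (subst (blk i <_) b lt))
              λ eq → running (subst (λ k → nth P (Config.pc (Stages.config (Stg k))) ≡ nothing) (sym eq) halted))))

theorem5 : (Δ : Set) → Infinite Δ →
    Undecidable (SatFin Δ) × Undecidable (SatInf Δ)
    × Undecidable (λ (I : InstanceMinus) → SatInf Δ (proj₁ I))
-- A decider for all instances over infinite words restricts to the fragment.
theorem5 Δ (f , f-injective) = finite , (λ decide → minus λ I → decide (proj₁ I)) , minus
  where
  open Reduction

  finite : Undecidable (SatFin Δ)
  finite decide P = map′ (finite-sound P) (finite-complete P f f-injective) (decide (instance-of P (Encoding.lossless P)))

  minus : Undecidable (λ (I : InstanceMinus) → SatInf Δ (proj₁ I))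
  minus decide P = map′ (infinite-sound P) (infinite-complete P f f-injective)
    (decide (instance-of P ⊤ᶠ , spec-minus P ⊤ᶠ ⊤-minus))
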